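{- $P(6,3)\leq 116$, $P(7,3)\leq 716$, $P(11,3)\leq 10!-10$, $P(13,3)\leq 12!-12$, and $P(17,3)\leq 16!-5$.
   Context: $S_n$ denotes the set of all permutations of $[n]=\{1,\dots,n\}$. For $\rho,\pi\in S_n$, the Kendall $\tau$-distance $d_K(\rho,\pi)$ is the minimum number of adjacent transpositions $(i,i+1)$, $1\leq i\leq n-1$, whose product equals $\rho\pi^{ -1}$. $P(n,d)$ denotes the maximum size of a subset $C\subseteq S_n$ such that $d_K(x,y)\geq d$ for all distinct $x,y\in C$. -}

module Defs where

open import Data.Nat using (ℕ; zero; suc; _<_; _≤_)
open import Data.Fin using (Fin; toℕ)
open import Data.Fin.Permutation using (Permutation′; _⟨$⟩ʳ_; _⟨$⟩ˡ_; transpose; id; _∘ₚ_; flip)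
open import Data.List using (List; []; _∷_; length)
open import Data.List.Relation.Unary.AllPairs using (AllPairs)
open import Data.Product using (Σ; _×_; _,_)
open import Relation.Binary.PropositionalEquality using (_≡_; _≢_)
open import Relation.Nullary using (¬_)

_≈ₚ_ : ∀ {n} → Permutation′ n → Permutation′ n → Set
_≈ₚ_ {n} σ τ = (x : Fin n) → σ ⟨$⟩ʳ x ≡ τ ⟨$⟩ʳ x

record AdjPair (n : ℕ) : Set where
  constructor adj
  field
    i j  : Fin n
    next : toℕ j ≡ suc (toℕ i)

adjTransp : ∀ {n} → AdjPair n → Permutation′ n
adjTransp (adj i j _) = transpose i j

prod : ∀ {n} → List (AdjPair n) → Permutation′ n
prod []       = id
prod (t ∷ ts) = adjTransp t ∘ₚ prod ts

-- ρ π⁻¹ (composition as functions: x ↦ ρ (π⁻¹ x)).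
ρπ⁻¹ : ∀ {n} → Permutation′ n → Permutation′ n → Permutation′ n
ρπ⁻¹ ρ π = flip π ∘ₚ ρ

ProdOf : ∀ {n} → ℕ → Permutation′ n → Permutation′ n → Set
ProdOf {n} k ρ π =
  Σ (List (AdjPair n)) λ ts → (length ts ≡ k) × (prod ts ≈ₚ ρπ⁻¹ ρ π)

KendallAtLeast : ∀ {n} → ℕ → Permutation′ n → Permutation′ n → Set
KendallAtLeast d ρ π = ∀ k → k < d → ¬ ProdOf k ρ π

IsCode : ∀ {n} → ℕ → List (Permutation′ n) → Set
IsCode d C = AllPairs (λ x y → ¬ (x ≈ₚ y) × KendallAtLeast d x y) C

P≤ : ℕ → ℕ → ℕ → Set
P≤ n d M = (C : List (Permutation′ n)) → IsCode d C → length C ≤ M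

{-# OPTIONS --safe #-}
-- Balls of radius one around codewords are disjoint, so the permutations of any cell (those with a
-- prescribed behaviour on some points) bound a linear combination of the numbers of codewords in
-- neighbouring cells; write s_k for the adjacent transpositions and the identity.
--
-- For a prime n ≥ 11, let a (u , v) be the number of codewords with π 0 = u and π 1 = v. Then
-- ∑ₖ a (s_k u , s_k v) ≤ (n - 2)! = n q + 1. A cell exceeding q forces its at most four neighbours
-- below q by a multiple of the excess, so the average is at most q and there are at most
-- n (n - 1) q = (n - 1)! - (n - 1) codewords.
--
-- For n = 7, no coset of S₄ × S₃ is completely covered by balls (a finite search), so at least
-- 35 permutations are uncovered. For n = 6, every coset of S₅ has two uncovered elements (again
-- by search); with aᵢ the number of codewords sending p to i, integrality then gives
-- 5 a₅ + 3 a₄ + a₃ ≤ 175 as soon as there are 117 codewords, and summing over p gives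
-- 9 * 117 ≤ 6 * 175, a contradiction.
module Submission where

open import Defs
open import Data.Nat using (ℕ; _∸_; _*_; _!)
open import Data.Product using (_×_)
open import Data.Bool using (Bool; true; false; if_then_else_; _∧_; _∨_; not; T)
open import Data.Bool.ListAction using (any)
open import Data.Bool.Properties as Boolₚ using (T-∧; T-∨; T-not-≡)
open import Data.Fin using (Fin; zero; suc; toℕ; inject₁; fromℕ<; punchIn; punchOut)
open import Data.Fin.Patterns
open import Data.Fin.Permutation
  using (Permutation′; _⟨$⟩ʳ_; _⟨$⟩ˡ_; transpose; id; _∘ₚ_; flip; inverseˡ; inverseʳ; remove;
    punchIn-permute)
open import Data.Fin.Properties as Finₚ
  using (toℕ-injective; toℕ-inject₁; toℕ<n; toℕ-fromℕ<; punchIn-punchOut; punchIn-injective; all?)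
open import Data.List
  using (List; []; _∷_; map; filter; _++_; concat; concatMap; tabulate; foldr; upTo; applyUpTo;
    reverse; tails; drop; length)
open import Data.List.Membership.Propositional using (_∈_; find; lose)
open import Data.List.Membership.Propositional.Properties
  using (∈-filter⁻; ∈-map⁺; ∈-map⁻; ∈-upTo⁺; ∈-upTo⁻)
open import Data.List.Properties
  using (length-++; length-map; ∷-injective; filter-≐; filter-none; filter-all; map-tabulate;
    tabulate-cong)
open import Data.List.Relation.Unary.All as All using (All; []; _∷_)
import Data.List.Relation.Unary.All.Properties as Allₚ
open import Data.List.Relation.Unary.AllPairs as AllPairs using (AllPairs; []; _∷_; allPairs?)
import Data.List.Relation.Unary.AllPairs.Properties as AllPairsₚ
open import Data.List.Relation.Unary.Any as Any using (Any; here; there)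
open import Data.List.Relation.Unary.Any.Properties using (any⁻)
open import Data.Maybe using (Maybe; just; nothing)
open import Data.Nat
open import Data.Nat.Properties as ℕₚ
open import Algebra.Properties.Semiring.Sum +-*-semiring
  using (sum; sum-cong-≗; ∑-distrib-+; ∑-comm; sum-permute; *-distribˡ-sum)
open import Data.Nat.Tactic.RingSolver using (solve-∀)
open import Data.Product using (∃; _,_; proj₁; proj₂)
open import Data.Sum using (_⊎_; inj₁; inj₂; [_,_]′)
open import Data.Unit using (⊤; tt)
open import Function using (_∘_; Equivalence)
open import Level using (0ℓ)
open import Relation.Binary.PropositionalEquality
open import Relation.Nullary using (¬_; Dec; does; yes; no; contradiction)
open import Relation.Nullary.Decidable using (dec-true; dec-false; from-yes; ¬?; _×-dec_; _→-dec_)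
open import Relation.Unary using (Pred; Decidable)

private variable
  m n N : ℕ
  A : Set

-- Finite sums

sum-mono-≤ : {f g : Fin n → ℕ} → (∀ i → f i ≤ g i) → sum f ≤ sum g
sum-mono-≤ {zero}  f≤g = z≤n
sum-mono-≤ {suc n} f≤g = +-mono-≤ (f≤g zero) (sum-mono-≤ (f≤g ∘ suc))

sum-const : ∀ n x → sum {n} (λ _ → x) ≡ n * x
sum-const zero    x = refl
sum-const (suc n) x = cong (x +_) (sum-const n x)

-- Adjacent transpositions

-- Stated on bare naturals so that the searches can evaluate it on lists; `toℕ-step` identifies it
-- with `step`.
swapValue : ℕ → ℕ → ℕ
swapValue i k = if k ≡ᵇ i then suc i else if k ≡ᵇ suc i then i else k

swapValue-left : ∀ i → swapValue i i ≡ suc i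
swapValue-left i rewrite dec-true (i ℕₚ.≟ i) refl = refl

swapValue-right : ∀ i → swapValue i (suc i) ≡ i
swapValue-right i rewrite dec-false (suc i ℕₚ.≟ i) 1+n≢n | dec-true (i ℕₚ.≟ i) refl = refl

swapValue-other : ∀ {i k} → k ≢ i → k ≢ suc i → swapValue i k ≡ k
swapValue-other {i} {k} k≢i k≢1+i
  rewrite dec-false (k ℕₚ.≟ i) k≢i | dec-false (k ℕₚ.≟ suc i) k≢1+i = refl

swapValue-involutive : ∀ i k → swapValue i (swapValue i k) ≡ k
swapValue-involutive i k with k ℕₚ.≟ i | k ℕₚ.≟ suc i
... | yes refl | _        = trans (cong (swapValue i) (swapValue-left i)) (swapValue-right i)
... | no _     | yes refl = trans (cong (swapValue i) (swapValue-right i)) (swapValue-left i)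
... | no k≢i   | no k≢1+i = trans (cong (swapValue i) (swapValue-other k≢i k≢1+i)) (swapValue-other k≢i k≢1+i)

-- Index zero is the identity, so that `c ∘ₚ step k` runs through the whole ball of radius one
-- around `c`. A step acts on values, that is, by left multiplication.
step : Fin (suc m) → Permutation′ (suc m)
step zero    = id
step (suc i) = transpose (inject₁ i) (suc i)

toℕ-step : ∀ (i : Fin m) x → toℕ (step (suc i) ⟨$⟩ʳ x) ≡ swapValue (toℕ i) (toℕ x)
toℕ-step i x with x Finₚ.≟ inject₁ i
... | yes refl rewrite toℕ-inject₁ i = sym (swapValue-left (toℕ i))
... | no x≢i with x Finₚ.≟ suc i
...   | yes refl = trans (toℕ-inject₁ i) (sym (swapValue-right (toℕ i)))
...   | no x≢1+i = sym (swapValue-other (λ eq → x≢i (toℕ-injective (trans eq (sym (toℕ-inject₁ i))))) (x≢1+i ∘ toℕ-injective))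

step-involutive : ∀ (k : Fin (suc m)) x → step k ⟨$⟩ʳ (step k ⟨$⟩ʳ x) ≡ x
step-involutive zero    x = refl
step-involutive (suc i) x = toℕ-injective (begin
  toℕ (step (suc i) ⟨$⟩ʳ (step (suc i) ⟨$⟩ʳ x))  ≡⟨ toℕ-step i (step (suc i) ⟨$⟩ʳ x) ⟩
  swapValue (toℕ i) (toℕ (step (suc i) ⟨$⟩ʳ x))  ≡⟨ cong (swapValue (toℕ i)) (toℕ-step i x) ⟩
  swapValue (toℕ i) (swapValue (toℕ i) (toℕ x))  ≡⟨ swapValue-involutive (toℕ i) (toℕ x) ⟩
  toℕ x                                          ∎)
  where open ≡-Reasoning

swapValue-moves : ∀ {i k} → swapValue i k ≢ k → k ≡ i ⊎ k ≡ suc i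
swapValue-moves {i} {k} moved with k ℕₚ.≟ i | k ℕₚ.≟ suc i
... | yes k≡i | _         = inj₁ k≡i
... | no _    | yes k≡1+i = inj₂ k≡1+i
... | no k≢i  | no k≢1+i  = contradiction (swapValue-other k≢i k≢1+i) moved

swapValue-up : ∀ {i k} → swapValue i k ≡ suc k → k ≡ i
swapValue-up {i} {k} up with swapValue-moves {i} {k} (λ fixed → 1+n≢n (trans (sym up) fixed))
... | inj₁ k≡i  = k≡i
... | inj₂ refl = contradiction (trans (sym (swapValue-right i)) up) (<⇒≢ (m<n+m i {2} z<s))

step-injective : ∀ {k l : Fin (suc m)} → (∀ x → step k ⟨$⟩ʳ x ≡ step l ⟨$⟩ʳ x) → k ≡ l
step-injective {k = zero}  {zero}  eq = refl
step-injective {k = zero}  {suc j} eq = contradiction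
  (trans (sym (toℕ-inject₁ j)) (trans (cong toℕ (eq (inject₁ j)))
    (trans (toℕ-step j (inject₁ j)) (trans (cong (swapValue (toℕ j)) (toℕ-inject₁ j)) (swapValue-left (toℕ j))))))
  (1+n≢n ∘ sym)
step-injective {k = suc i} {zero}  eq = sym (step-injective (sym ∘ eq))
-- Both steps raise the value `i` by one, and `j` is the only value that `swapValue j` raises.
step-injective {k = suc i} {suc j} eq = cong suc (toℕ-injective (swapValue-up (begin
  swapValue (toℕ j) (toℕ i)            ≡⟨ cong (swapValue (toℕ j)) (toℕ-inject₁ i) ⟨
  swapValue (toℕ j) (toℕ (inject₁ i))  ≡⟨ toℕ-step j (inject₁ i) ⟨
  toℕ (step (suc j) ⟨$⟩ʳ inject₁ i)    ≡⟨ cong toℕ (eq (inject₁ i)) ⟨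
  toℕ (step (suc i) ⟨$⟩ʳ inject₁ i)    ≡⟨ toℕ-step i (inject₁ i) ⟩
  swapValue (toℕ i) (toℕ (inject₁ i))  ≡⟨ cong (swapValue (toℕ i)) (toℕ-inject₁ i) ⟩
  swapValue (toℕ i) (toℕ i)            ≡⟨ swapValue-left (toℕ i) ⟩
  suc (toℕ i)                          ∎)))
  where open ≡-Reasoning

-- Counting permutations

count : {P : Pred A 0ℓ} → Decidable P → List A → ℕ
count P? xs = length (filter P? xs)

Distinct : List (Permutation′ n) → Set
Distinct = AllPairs (λ σ τ → ¬ (σ ≈ₚ τ))

-- A cardinality bound up to pointwise equality, phrased through lists without repetitions so that
-- no enumeration of the permutations is needed.
AtMost : ℕ → Pred (Permutation′ n) 0ℓ → Set
AtMost N P = ∀ D → Distinct D → All P D → length D ≤ N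

indicator : Bool → ℕ
indicator b = if b then 1 else 0

count-∷ : {P : Pred A 0ℓ} (P? : Decidable P) (x : A) (xs : List A) →
          count P? (x ∷ xs) ≡ indicator (does (P? x)) + count P? xs
count-∷ P? x xs with does (P? x)
... | true  = refl
... | false = refl

sum-indicator-≟ : (x : Fin n) → sum (λ v → indicator (does (x Finₚ.≟ v))) ≡ 1
sum-indicator-≟ {suc n} zero    = cong suc (trans (sum-const n 0) (*-zeroʳ n))
sum-indicator-≟ {suc n} (suc x) = sum-indicator-≟ x

length≡sum-count : (key : A → Fin n) (xs : List A) →
                   length xs ≡ sum (λ v → count (λ x → key x Finₚ.≟ v) xs)
length≡sum-count {n = n} key []       = sym (trans (sum-const n 0) (*-zeroʳ n))
length≡sum-count {n = n} key (x ∷ xs) = sym (begin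
  sum (λ v → count (λ y → key y Finₚ.≟ v) (x ∷ xs))
    ≡⟨ sum-cong-≗ (λ v → count-∷ (λ y → key y Finₚ.≟ v) x xs) ⟩
  sum (λ v → indicator (does (key x Finₚ.≟ v)) + count (λ y → key y Finₚ.≟ v) xs)
    ≡⟨ ∑-distrib-+ (λ v → indicator (does (key x Finₚ.≟ v))) _ ⟩
  sum (λ v → indicator (does (key x Finₚ.≟ v))) + sum (λ v → count (λ y → key y Finₚ.≟ v) xs)
    ≡⟨ cong₂ _+_ (sum-indicator-≟ (key x)) (sym (length≡sum-count key xs)) ⟩
  suc (length xs) ∎)
  where open ≡-Reasoning

remove-reflects-≈ : ∀ (p : Fin (suc n)) (σ τ : Permutation′ (suc n)) → σ ⟨$⟩ʳ p ≡ τ ⟨$⟩ʳ p →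
                    remove p σ ≈ₚ remove p τ → σ ≈ₚ τ
remove-reflects-≈ p σ τ eq r x with p Finₚ.≟ x
... | yes refl = eq
... | no p≢x   = begin
  σ ⟨$⟩ʳ x                                         ≡⟨ cong (σ ⟨$⟩ʳ_) (punchIn-punchOut p≢x) ⟨
  σ ⟨$⟩ʳ punchIn p (punchOut p≢x)                  ≡⟨ punchIn-permute σ p _ ⟩
  punchIn (σ ⟨$⟩ʳ p) (remove p σ ⟨$⟩ʳ punchOut p≢x) ≡⟨ cong₂ punchIn eq (r (punchOut p≢x)) ⟩
  punchIn (τ ⟨$⟩ʳ p) (remove p τ ⟨$⟩ʳ punchOut p≢x) ≡⟨ punchIn-permute τ p _ ⟨
  τ ⟨$⟩ʳ punchIn p (punchOut p≢x)                  ≡⟨ cong (τ ⟨$⟩ʳ_) (punchIn-punchOut p≢x) ⟩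
  τ ⟨$⟩ʳ x                                         ∎
  where open ≡-Reasoning

-- All members of `P` agree at `p`, so deleting `p` is injective on them and carries them into `Q`.
atMost-remove : ∀ {P : Pred (Permutation′ (suc n)) 0ℓ} {Q : Pred (Permutation′ n) 0ℓ} p u →
                (∀ {σ} → P σ → σ ⟨$⟩ʳ p ≡ u × Q (remove p σ)) → AtMost N Q → AtMost N P
atMost-remove {P = P} p u reduce bound D distinct all = subst (_≤ _) (length-map (remove p) D)
  (bound (map (remove p) D) (AllPairsₚ.map⁺ (removed distinct all)) (Allₚ.map⁺ (All.map (proj₂ ∘ reduce) all)))
  where
  removed : ∀ {D} → Distinct D → All P D → AllPairs (λ σ τ → ¬ (remove p σ ≈ₚ remove p τ)) D
  removed []       []       = []
  removed {σ ∷ _} (σ≉ ∷ d) (pσ ∷ a) =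
    All.zipWith (λ { {τ} (σ≉τ , pτ) r → σ≉τ (remove-reflects-≈ p σ τ
      (trans (proj₁ (reduce pσ)) (sym (proj₁ (reduce pτ)))) r) }) (σ≉ , a)
    ∷ removed d a

atMost-all : ∀ n → AtMost {n} (n !) (λ _ → ⊤)
atMost-all zero []          _               _ = z≤n
atMost-all zero (_ ∷ [])    _               _ = s≤s z≤n
atMost-all zero (σ ∷ τ ∷ D) ((σ≉τ ∷ _) ∷ _) _ = contradiction (λ ()) σ≉τ
atMost-all (suc n) D distinct _ = begin
  length D                                              ≡⟨ length≡sum-count (_⟨$⟩ʳ zero) D ⟩
  sum (λ v → count (λ σ → σ ⟨$⟩ʳ zero Finₚ.≟ v) D)      ≤⟨ sum-mono-≤ fibre ⟩
  sum {suc n} (λ _ → n !)                               ≡⟨ sum-const (suc n) (n !) ⟩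
  suc n !                                               ∎
  where
  open ≤-Reasoning
  fibre : ∀ v → count (λ σ → σ ⟨$⟩ʳ zero Finₚ.≟ v) D ≤ n !
  fibre v = atMost-remove zero v (_, tt) (atMost-all n) _
    (AllPairsₚ.filter⁺ (λ σ → σ ⟨$⟩ʳ zero Finₚ.≟ v) distinct) (Allₚ.all-filter (λ σ → σ ⟨$⟩ʳ zero Finₚ.≟ v) D)

atMost-one : ∀ (p u : Fin (suc n)) → AtMost (n !) (λ σ → σ ⟨$⟩ʳ p ≡ u)
atMost-one p u = atMost-remove p u (_, tt) (atMost-all _)

-- Deleting position 0 with its value `u` turns position 1 into position 0 and its value `v` into
-- `punchOut u≢v`; one prescribed value remains.
atMost-two : ∀ {u v : Fin (suc (suc n))} → u ≢ v →
             AtMost (n !) (λ σ → σ ⟨$⟩ʳ zero ≡ u × σ ⟨$⟩ʳ suc zero ≡ v)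
atMost-two {u = u} {v} u≢v = atMost-remove zero u
  (λ { {σ} (σ0≡u , σ1≡v) → σ0≡u , punchIn-injective u _ _ (begin
    punchIn u (remove zero σ ⟨$⟩ʳ zero)              ≡⟨ cong (λ w → punchIn w (remove zero σ ⟨$⟩ʳ zero)) σ0≡u ⟨
    punchIn (σ ⟨$⟩ʳ zero) (remove zero σ ⟨$⟩ʳ zero)  ≡⟨ punchIn-permute σ zero zero ⟨
    σ ⟨$⟩ʳ suc zero                                  ≡⟨ σ1≡v ⟩
    v                                                ≡⟨ punchIn-punchOut u≢v ⟨
    punchIn u (punchOut u≢v)                         ∎) })
  (atMost-one zero (punchOut u≢v))
  where open ≡-Reasoning

AllPairs-lookup : {R : A → A → Set} {xs : List A} {x y : A} → AllPairs R xs →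
                  x ∈ xs → y ∈ xs → x ≡ y ⊎ R x y ⊎ R y x
AllPairs-lookup (_ ∷ _)   (here refl) (here refl) = inj₁ refl
AllPairs-lookup (rx ∷ _)  (here refl) (there y∈)  = inj₂ (inj₁ (All.lookup rx y∈))
AllPairs-lookup (ry ∷ _)  (there x∈)  (here refl) = inj₂ (inj₂ (All.lookup ry x∈))
AllPairs-lookup (_ ∷ rxs) (there x∈)  (there y∈)  = AllPairs-lookup rxs x∈ y∈

length-concat-tabulate : (f : Fin n → List A) → length (concat (tabulate f)) ≡ sum (length ∘ f)
length-concat-tabulate {zero}  f = refl
length-concat-tabulate {suc n} f =
  trans (length-++ (f zero)) (cong (length (f zero) +_) (length-concat-tabulate (f ∘ suc)))

-- Codes of minimum distance three

adjacent : Fin m → AdjPair (suc m)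
adjacent i = adj (inject₁ i) (suc i) (cong suc (sym (toℕ-inject₁ i)))

-- Steps are involutions, so a common point makes the quotient of `ρ` by `π` equal to step `l`
-- followed by step `k`, a product of at most two adjacent transpositions. The word of `l` stands
-- first because `prod` applies the head of a list first.
balls-meet : ∀ {ρ π : Permutation′ (suc m)} k l → (ρ ∘ₚ step k) ≈ₚ (π ∘ₚ step l) →
             ∃ λ d → d < 3 × ProdOf d ρ π
balls-meet {ρ = ρ} {π} k l eq = length (word l ++ word k) , short k l , word l ++ word k , refl , λ z → begin
  prod (word l ++ word k) ⟨$⟩ʳ z                       ≡⟨ prod-word k l z ⟩
  step k ⟨$⟩ʳ (step l ⟨$⟩ʳ z)                          ≡⟨ cong (λ y → step k ⟨$⟩ʳ (step l ⟨$⟩ʳ y)) (inverseʳ π) ⟨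
  step k ⟨$⟩ʳ (step l ⟨$⟩ʳ (π ⟨$⟩ʳ (π ⟨$⟩ˡ z)))        ≡⟨ cong (step k ⟨$⟩ʳ_) (eq (π ⟨$⟩ˡ z)) ⟨
  step k ⟨$⟩ʳ (step k ⟨$⟩ʳ (ρ ⟨$⟩ʳ (π ⟨$⟩ˡ z)))        ≡⟨ step-involutive k _ ⟩
  ρ ⟨$⟩ʳ (π ⟨$⟩ˡ z)                                    ∎
  where
  open ≡-Reasoning
  word : Fin (suc m) → List (AdjPair (suc m))
  word zero    = []
  word (suc i) = adjacent i ∷ []
  short : ∀ k l → length (word l ++ word k) < 3
  short zero    zero    = s≤s z≤n
  short zero    (suc _) = s≤s (s≤s z≤n)
  short (suc _) zero    = s≤s (s≤s z≤n)
  short (suc _) (suc _) = s≤s (s≤s (s≤s z≤n))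
  prod-word : ∀ k l z → prod (word l ++ word k) ⟨$⟩ʳ z ≡ step k ⟨$⟩ʳ (step l ⟨$⟩ʳ z)
  prod-word zero    zero    z = refl
  prod-word zero    (suc _) z = refl
  prod-word (suc _) zero    z = refl
  prod-word (suc _) (suc _) z = refl

module Code (C : List (Permutation′ (suc m))) (code : IsCode 3 C) where

  -- Entries at two different places of `C` would be too close. `AllPairs` compares them in list
  -- order only, hence the two mirrored cases.
  balls-disjoint : ∀ {c d} k l → c ∈ C → d ∈ C → (c ∘ₚ step k) ≈ₚ (d ∘ₚ step l) → c ≡ d
  balls-disjoint {c} {d} k l c∈ d∈ eq with AllPairs-lookup code c∈ d∈
  ... | inj₁ c≡d               = c≡d
  ... | inj₂ (inj₁ (_ , far)) = let e , e<3 , p = balls-meet {ρ = c} {d} k l eq in contradiction p (far e e<3)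
  ... | inj₂ (inj₂ (_ , far)) = let e , e<3 , p = balls-meet {ρ = d} {c} l k (sym ∘ eq) in contradiction p (far e e<3)

  Covers : Permutation′ (suc m) → Pred (Permutation′ (suc m)) 0ℓ
  Covers σ c = ∃ λ k → (c ∘ₚ step k) ≈ₚ σ

  Covered : Pred (Permutation′ (suc m)) 0ℓ
  Covered σ = Any (Covers σ) C

  covered? : Decidable Covered
  covered? σ = Any.any? (λ c → Finₚ.any? λ k → Finₚ.all? λ x → step k ⟨$⟩ʳ (c ⟨$⟩ʳ x) Finₚ.≟ σ ⟨$⟩ʳ x) C

  module _ {P : Pred (Permutation′ (suc m)) 0ℓ} (P? : Decidable P) where

    moved : Fin (suc m) → List (Permutation′ (suc m))
    moved k = map (_∘ₚ step k) (filter (λ c → P? (c ∘ₚ step k)) C)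

    codeword : ∀ k {c} → c ∈ filter (λ c → P? (c ∘ₚ step k)) C → c ∈ C
    codeword k = proj₁ ∘ ∈-filter⁻ (λ c → P? (c ∘ₚ step k))

    moved-distinct : ∀ k → Distinct (moved k)
    moved-distinct k = AllPairsₚ.map⁺ (AllPairsₚ.filter⁺ _ (AllPairs.map
      (λ { {c} {d} (c≉d , _) eq → c≉d (λ x → trans (sym (step-involutive k _))
             (trans (cong (step k ⟨$⟩ʳ_) (eq x)) (step-involutive k _))) }) code))

    moved-disjoint : ∀ {k l} → k ≢ l → All (λ σ → All (λ τ → ¬ (σ ≈ₚ τ)) (moved l)) (moved k)
    moved-disjoint {k} {l} k≢l =
      Allₚ.map⁺ (All.tabulate λ {c} c∈ → Allₚ.map⁺ (All.tabulate λ {d} d∈ eq → k≢l (same c∈ d∈ eq)))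
      where
      same : ∀ {c d} → c ∈ filter (λ c → P? (c ∘ₚ step k)) C → d ∈ filter (λ c → P? (c ∘ₚ step l)) C →
             (c ∘ₚ step k) ≈ₚ (d ∘ₚ step l) → k ≡ l
      same {c} c∈ d∈ eq with balls-disjoint k l (codeword k c∈) (codeword l d∈) eq
      -- With the codewords identified, `c` cancels on the right and the two steps agree everywhere.
      ... | refl = step-injective λ x → subst (λ y → step k ⟨$⟩ʳ y ≡ step l ⟨$⟩ʳ y) (inverseʳ c) (eq (c ⟨$⟩ˡ x))

    -- The lists `moved k`, for all `k`, and `E` are concatenated into one list of members of `P`
    -- without repetitions: steps are injective, balls are disjoint, and nothing in `E` lies in a
    -- ball. Uncovered permutations thus sharpen the bound one for one.
    packing-bound : AtMost N P → ∀ E → Distinct E → All P E → All (¬_ ∘ Covered) E →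
                    length E + sum (λ k → count (λ c → P? (c ∘ₚ step k)) C) ≤ N
    packing-bound {N} atMost E distinct all uncovered = subst (_≤ N) size
      (atMost (E ++ concat (tabulate moved))
        (AllPairsₚ.++⁺ distinct
          (AllPairsₚ.concat⁺ (Allₚ.tabulate⁺ moved-distinct) (AllPairsₚ.tabulate⁺ moved-disjoint))
          (All.map (λ {σ} → separate σ) uncovered))
        (Allₚ.++⁺ all (Allₚ.concat⁺ (Allₚ.tabulate⁺ λ k → Allₚ.map⁺ (Allₚ.all-filter (λ c → P? (c ∘ₚ step k)) C)))))
      where
      size : length (E ++ concat (tabulate moved)) ≡ length E + sum (λ k → count (λ c → P? (c ∘ₚ step k)) C)
      size = trans (length-++ E) (cong (length E +_) (trans (length-concat-tabulate moved)
        (sum-cong-≗ λ k → length-map (_∘ₚ step k) (filter (λ c → P? (c ∘ₚ step k)) C))))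
      avoids : ∀ σ → ¬ Covered σ → ∀ k →
               All (λ c → ¬ (σ ≈ₚ (c ∘ₚ step k))) (filter (λ c → P? (c ∘ₚ step k)) C)
      avoids σ ¬cov k = All.tabulate λ {c} c∈ eq →
        ¬cov (lose {P = Covers σ} (codeword k c∈) (k , λ x → sym (eq x)))
      separate : ∀ σ → ¬ Covered σ → All (λ τ → ¬ (σ ≈ₚ τ)) (concat (tabulate moved))
      separate σ ¬cov = Allₚ.concat⁺ (Allₚ.tabulate⁺ λ k → Allₚ.map⁺ {f = _∘ₚ step k} (avoids σ ¬cov k))

  total-bound : ∀ E → Distinct E → All (¬_ ∘ Covered) E → length E + suc m * length C ≤ suc m !
  total-bound E distinct uncovered = begin
    length E + suc m * length C                   ≡⟨ cong (length E +_) (sum-const (suc m) (length C)) ⟨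
    length E + sum {suc m} (λ _ → length C)       ≡⟨ cong (length E +_) (sum-cong-≗ {suc m} λ _ → count-all) ⟨
    length E + sum {suc m} (λ _ → count any? C)   ≤⟨ packing-bound any? (atMost-all (suc m)) E
                                                           distinct (All.universal (λ _ → tt) E) uncovered ⟩
    suc m !                                       ∎
    where
    open ≤-Reasoning
    any? : Decidable (λ (_ : Permutation′ (suc m)) → ⊤)
    any? _ = yes tt
    count-all : count any? C ≡ length C
    count-all = cong length (filter-all any? (All.universal (λ _ → tt) C))

-- Cells of two prescribed values

-- Shifts a step from the codeword to the prescribed value, so that counts of moved codewords become
-- counts in neighbouring cells.
step-⟨$⟩ : ∀ (k : Fin (suc m)) {x u} → step k ⟨$⟩ʳ x ≡ u → x ≡ step k ⟨$⟩ˡ u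
step-⟨$⟩ k eq = trans (sym (inverseˡ (step k))) (cong (step k ⟨$⟩ˡ_) eq)

step-⟨$⟩′ : ∀ (k : Fin (suc m)) {x u} → x ≡ step k ⟨$⟩ˡ u → step k ⟨$⟩ʳ x ≡ u
step-⟨$⟩′ k eq = trans (cong (step k ⟨$⟩ʳ_) eq) (inverseʳ (step k))

count-≐ : {P Q : Pred A 0ℓ} (P? : Decidable P) (Q? : Decidable Q) → (∀ {x} → P x → Q x) → (∀ {x} → Q x → P x) →
          ∀ xs → count P? xs ≡ count Q? xs
count-≐ P? Q? P⊆Q Q⊆P xs = cong length (filter-≐ P? Q? (P⊆Q , Q⊆P) xs)

count-×-dec : {P Q : Pred A 0ℓ} (P? : Decidable P) (Q? : Decidable Q) (xs : List A) →
              count (λ x → P? x ×-dec Q? x) xs ≡ count Q? (filter P? xs)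
count-×-dec P? Q? []       = refl
count-×-dec P? Q? (x ∷ xs) with P? x
... | no _  = count-×-dec P? Q? xs
... | yes _ with does (Q? x)
...   | true  = cong suc (count-×-dec P? Q? xs)
...   | false = count-×-dec P? Q? xs

-- Double sums over cells

sum₂ : (Fin n → Fin n → ℕ) → ℕ
sum₂ f = sum λ u → sum (f u)

sum₂-mono-≤ : {f g : Fin n → Fin n → ℕ} → (∀ u v → f u v ≤ g u v) → sum₂ f ≤ sum₂ g
sum₂-mono-≤ f≤g = sum-mono-≤ λ u → sum-mono-≤ (f≤g u)

sum₂-cong : {f g : Fin n → Fin n → ℕ} → (∀ u v → f u v ≡ g u v) → sum₂ f ≡ sum₂ g
sum₂-cong f≡g = sum-cong-≗ λ u → sum-cong-≗ (f≡g u)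

sum₂-+ : (f g : Fin n → Fin n → ℕ) → sum₂ (λ u v → f u v + g u v) ≡ sum₂ f + sum₂ g
sum₂-+ f g = trans (sum-cong-≗ λ u → ∑-distrib-+ (f u) (g u)) (∑-distrib-+ (sum ∘ f) (sum ∘ g))

sum₂-* : ∀ x (f : Fin n → Fin n → ℕ) → sum₂ (λ u v → x * f u v) ≡ x * sum₂ f
sum₂-* x f = trans (sum-cong-≗ λ u → sym (*-distribˡ-sum x (f u))) (sym (*-distribˡ-sum x (sum ∘ f)))

sum₂-permute : (f : Fin n → Fin n → ℕ) (π : Permutation′ n) → sum₂ (λ u v → f (π ⟨$⟩ʳ u) (π ⟨$⟩ʳ v)) ≡ sum₂ f
sum₂-permute f π = trans (sum-cong-≗ λ u → sym (sum-permute (f (π ⟨$⟩ʳ u)) π)) (sym (sum-permute (sum ∘ f) π))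

sum₂-sum : (f : Fin m → Fin n → Fin n → ℕ) →
           sum₂ (λ u v → sum (λ k → f k u v)) ≡ sum (λ k → sum₂ (f k))
sum₂-sum f = trans (sum-cong-≗ λ u → ∑-comm (λ v k → f k u v)) (∑-comm (λ u k → sum (f k u)))

-- Discharging excess against deficit

fixes? : (k : Fin (suc m)) (u v : Fin (suc m)) → Dec (step k ⟨$⟩ˡ u ≡ u × step k ⟨$⟩ˡ v ≡ v)
fixes? k u v = (step k ⟨$⟩ˡ u Finₚ.≟ u) ×-dec (step k ⟨$⟩ˡ v Finₚ.≟ v)

-- A value is moved by at most two steps, so at most four of the `m + 1` steps move `u` or `v`. This
-- is the source of the hypothesis `many-fixed`, which is evaluated for each length.
fixing : (u v : Fin (suc m)) → ℕ
fixing u v = sum λ k → indicator (does (fixes? k u v))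

excess+deficit : ∀ a q → a + (q ∸ a) ≡ q + (a ∸ q)
excess+deficit zero    q       = trans (sym (+-identityʳ q)) (cong (q +_) (sym (0∸n≡0 q)))
excess+deficit (suc a) zero    = +-identityʳ (suc a)
excess+deficit (suc a) (suc q) = cong suc (excess+deficit a q)

module Discharging (a : Fin (suc m) → Fin (suc m) → ℕ) (q : ℕ) (8≤m : 8 ≤ m)
  (many-fixed : ∀ (u v : Fin (suc m)) → m ≤ 3 + fixing u v)
  (row : ∀ u v → sum (λ k → a (step k ⟨$⟩ˡ u) (step k ⟨$⟩ˡ v)) ≤ suc (suc m * q)) where

  e d : Fin (suc m) → Fin (suc m) → ℕ
  e u v = a u v ∸ q
  d u v = q ∸ a u v

  around : Fin (suc m) → Fin (suc m) → ℕ
  around u v = sum λ k → d (step k ⟨$⟩ˡ u) (step k ⟨$⟩ˡ v)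

  -- The row of a cell contains that cell once per fixing step. Since `a + d` is the maximum of `a`
  -- and `q`, each such occurrence adds `e` above the mean, and every other one reaches the mean
  -- after adding its deficit; the row exceeds the mean by at most one in total.
  excess-charge : ∀ u v → e u v * fixing u v ≤ suc (around u v)
  excess-charge u v = +-cancelˡ-≤ (suc m * q) _ _ (begin
    suc m * q + e u v * fixing u v
      ≡⟨ cong₂ _+_ (sym (sum-const (suc m) q)) (*-distribˡ-sum (e u v) (λ k → indicator (does (fixes? k u v)))) ⟩
    sum {suc m} (λ _ → q) + sum (λ k → e u v * indicator (does (fixes? k u v)))
      ≡⟨ ∑-distrib-+ (λ _ → q) (λ k → e u v * indicator (does (fixes? k u v))) ⟨
    sum (λ k → q + e u v * indicator (does (fixes? k u v)))
      ≤⟨ sum-mono-≤ (λ k → pointwise k (fixes? k u v)) ⟩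
    sum (λ k → a (step k ⟨$⟩ˡ u) (step k ⟨$⟩ˡ v) + d (step k ⟨$⟩ˡ u) (step k ⟨$⟩ˡ v))
      ≡⟨ ∑-distrib-+ (λ k → a (step k ⟨$⟩ˡ u) (step k ⟨$⟩ˡ v)) (λ k → d (step k ⟨$⟩ˡ u) (step k ⟨$⟩ˡ v)) ⟩
    sum (λ k → a (step k ⟨$⟩ˡ u) (step k ⟨$⟩ˡ v)) + around u v
      ≤⟨ +-monoˡ-≤ (around u v) (row u v) ⟩
    suc (suc m * q) + around u v
      ≡⟨ +-suc (suc m * q) (around u v) ⟨
    suc m * q + suc (around u v) ∎)
    where
    open ≤-Reasoning
    pointwise : ∀ k (fixed? : Dec (step k ⟨$⟩ˡ u ≡ u × step k ⟨$⟩ˡ v ≡ v)) →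
                q + e u v * indicator (does fixed?) ≤
                a (step k ⟨$⟩ˡ u) (step k ⟨$⟩ˡ v) + d (step k ⟨$⟩ˡ u) (step k ⟨$⟩ˡ v)
    pointwise k (yes (fu , fv)) rewrite fu | fv | *-identityʳ (e u v) = ≤-reflexive (sym (excess+deficit (a u v) q))
    pointwise k (no _)          rewrite *-zeroʳ (e u v) | +-identityʳ q = m≤n+m∸n q (a (step k ⟨$⟩ˡ u) (step k ⟨$⟩ˡ v))

  deficit-charge : ∀ u v → d u v * fixing u v ≤ around u v
  deficit-charge u v = begin
    d u v * fixing u v                                          ≡⟨ *-distribˡ-sum (d u v) (λ k → indicator (does (fixes? k u v))) ⟩
    sum (λ k → d u v * indicator (does (fixes? k u v)))         ≤⟨ sum-mono-≤ (λ k → pointwise k (fixes? k u v)) ⟩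
    around u v                                                  ∎
    where
    open ≤-Reasoning
    pointwise : ∀ k (fixed? : Dec (step k ⟨$⟩ˡ u ≡ u × step k ⟨$⟩ˡ v ≡ v)) →
                d u v * indicator (does fixed?) ≤ d (step k ⟨$⟩ˡ u) (step k ⟨$⟩ˡ v)
    pointwise k (yes (fu , fv)) rewrite fu | fv | *-identityʳ (d u v) = ≤-refl
    pointwise k (no _)          rewrite *-zeroʳ (d u v) = z≤n

  -- At each cell one of `e` and `d` vanishes, which leaves one of the two preceding estimates. The
  -- weights are chosen so that `4 + (m ∸ 3)` is the number of steps.
  charge : ∀ u v → 4 * e u v + (m ∸ 3) * d u v ≤ around u v
  charge u v with a u v ≤? q
  ... | yes a≤q = begin
    4 * (a u v ∸ q) + (m ∸ 3) * d u v  ≡⟨ cong (λ x → 4 * x + (m ∸ 3) * d u v) (m≤n⇒m∸n≡0 a≤q) ⟩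
    (m ∸ 3) * d u v                    ≤⟨ *-monoˡ-≤ (d u v) (m≤n+o⇒m∸n≤o m 3 (many-fixed u v)) ⟩
    fixing u v * d u v                 ≡⟨ *-comm (fixing u v) (d u v) ⟩
    d u v * fixing u v                 ≤⟨ deficit-charge u v ⟩
    around u v                         ∎
    where open ≤-Reasoning
  ... | no a≰q = begin
    4 * e u v + (m ∸ 3) * (q ∸ a u v)  ≡⟨ cong (λ x → 4 * e u v + (m ∸ 3) * x) (m≤n⇒m∸n≡0 (<⇒≤ (≰⇒> a≰q))) ⟩
    4 * e u v + (m ∸ 3) * 0            ≡⟨ cong (4 * e u v +_) (*-zeroʳ (m ∸ 3)) ⟩
    4 * e u v + 0                      ≡⟨ +-identityʳ (4 * e u v) ⟩
    4 * e u v                          ≤⟨ s≤s⁻¹ (begin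
      -- The excess is at least one here, so a fifth copy of it absorbs the slack of one in the row.
      suc (4 * e u v)                    ≤⟨ +-monoˡ-≤ (4 * e u v) (m<n⇒0<n∸m (≰⇒> a≰q)) ⟩
      5 * e u v                          ≤⟨ *-monoˡ-≤ (e u v) 5≤fixing ⟩
      fixing u v * e u v                 ≡⟨ *-comm (fixing u v) (e u v) ⟩
      e u v * fixing u v                 ≤⟨ excess-charge u v ⟩
      suc (around u v)                   ∎) ⟩
    around u v                         ∎
    where
    open ≤-Reasoning
    5≤fixing : 5 ≤ fixing u v
    5≤fixing = +-cancelˡ-≤ 3 5 (fixing u v) (≤-trans 8≤m (many-fixed u v))

  -- Each step permutes the cells, so every deficit is seen once per step.
  sum₂-around : sum₂ around ≡ suc m * sum₂ d
  sum₂-around = begin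
    sum₂ around
      ≡⟨ sum₂-sum (λ k u v → d (step k ⟨$⟩ˡ u) (step k ⟨$⟩ˡ v)) ⟩
    sum (λ k → sum₂ (λ u v → d (step k ⟨$⟩ˡ u) (step k ⟨$⟩ˡ v)))
      ≡⟨ sum-cong-≗ (λ k → sum₂-permute d (flip (step k))) ⟩
    sum {suc m} (λ _ → sum₂ d)
      ≡⟨ sum-const (suc m) (sum₂ d) ⟩
    suc m * sum₂ d ∎
    where open ≡-Reasoning

  excess≤deficit : sum₂ e ≤ sum₂ d
  excess≤deficit = *-cancelˡ-≤ 4 (+-cancelʳ-≤ ((m ∸ 3) * sum₂ d) _ _ (begin
    4 * sum₂ e + (m ∸ 3) * sum₂ d
      ≡⟨ cong₂ _+_ (sum₂-* 4 e) (sum₂-* (m ∸ 3) d) ⟨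
    sum₂ (λ u v → 4 * e u v) + sum₂ (λ u v → (m ∸ 3) * d u v)
      ≡⟨ sum₂-+ (λ u v → 4 * e u v) (λ u v → (m ∸ 3) * d u v) ⟨
    sum₂ (λ u v → 4 * e u v + (m ∸ 3) * d u v)
      ≤⟨ sum₂-mono-≤ charge ⟩
    sum₂ around
      ≡⟨ sum₂-around ⟩
    suc m * sum₂ d
      ≡⟨ cong (λ x → suc x * sum₂ d) (m+[n∸m]≡n (≤-trans (s≤s (s≤s (s≤s z≤n))) 8≤m)) ⟨
    (4 + (m ∸ 3)) * sum₂ d
      ≡⟨ *-distribʳ-+ (sum₂ d) 4 (m ∸ 3) ⟩
    4 * sum₂ d + (m ∸ 3) * sum₂ d ∎))
    where open ≤-Reasoning

  sum₂-bound : sum₂ a ≤ suc m * (suc m * q)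
  sum₂-bound = +-cancelʳ-≤ (sum₂ d) _ _ (begin
    sum₂ a + sum₂ d                      ≡⟨ sum₂-+ a d ⟨
    sum₂ (λ u v → a u v + d u v)         ≡⟨ sum₂-cong (λ u v → excess+deficit (a u v) q) ⟩
    sum₂ (λ u v → q + e u v)             ≡⟨ sum₂-+ (λ _ _ → q) e ⟩
    sum₂ {suc m} (λ _ _ → q) + sum₂ e    ≡⟨ cong (_+ sum₂ e) (trans
      (sum-cong-≗ {suc m} (λ _ → sum-const (suc m) q)) (sum-const (suc m) (suc m * q))) ⟩
    suc m * (suc m * q) + sum₂ e         ≤⟨ +-monoʳ-≤ (suc m * (suc m * q)) excess≤deficit ⟩
    suc m * (suc m * q) + sum₂ d         ∎)
    where open ≤-Reasoning

-- Codewords counted by their values at two positions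

module TwoPoint (C : List (Permutation′ (suc (suc m)))) (code : IsCode 3 C) (q : ℕ) (8≤1+m : 8 ≤ suc m)
  (many-fixed : ∀ (u v : Fin (suc (suc m))) → suc m ≤ 3 + fixing u v)
  (cell-size : m ! ≡ suc (suc (suc m) * q)) where

  open Code C code

  InCell : (u v : Fin (suc (suc m))) → Pred (Permutation′ (suc (suc m))) 0ℓ
  InCell u v σ = σ ⟨$⟩ʳ zero ≡ u × σ ⟨$⟩ʳ suc zero ≡ v

  inCell? : ∀ u v → Decidable (InCell u v)
  inCell? u v σ = (σ ⟨$⟩ʳ zero Finₚ.≟ u) ×-dec (σ ⟨$⟩ʳ suc zero Finₚ.≟ v)

  -- The impossible cells u = v are filled with the mean, so that they satisfy the same inequalities.
  occupancy : Fin (suc (suc m)) → Fin (suc (suc m)) → ℕ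
  occupancy u v = if does (u Finₚ.≟ v) then q else count (inCell? u v) C

  occupancy-diagonal : ∀ u → occupancy u u ≡ q
  occupancy-diagonal u rewrite dec-true (u Finₚ.≟ u) refl = refl

  occupancy-off-diagonal : ∀ {u v} → u ≢ v → occupancy u v ≡ count (inCell? u v) C
  occupancy-off-diagonal {u} {v} u≢v rewrite dec-false (u Finₚ.≟ v) u≢v = refl

  row : ∀ u v → sum (λ k → occupancy (step k ⟨$⟩ˡ u) (step k ⟨$⟩ˡ v)) ≤ suc (suc (suc m) * q)
  row u v = by-cases (u Finₚ.≟ v)
    where
    diagonal-row : ∀ u → sum (λ k → occupancy (step k ⟨$⟩ˡ u) (step k ⟨$⟩ˡ u)) ≤ suc (suc (suc m) * q)
    diagonal-row u = begin
      sum (λ k → occupancy (step k ⟨$⟩ˡ u) (step k ⟨$⟩ˡ u))  ≡⟨ sum-cong-≗ (λ k → occupancy-diagonal (step k ⟨$⟩ˡ u)) ⟩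
      sum {suc (suc m)} (λ _ → q)                    ≡⟨ sum-const (suc (suc m)) q ⟩
      suc (suc m) * q                                ≤⟨ n≤1+n _ ⟩
      suc (suc (suc m) * q)                          ∎
      where open ≤-Reasoning
    cell-row : u ≢ v → sum (λ k → occupancy (step k ⟨$⟩ˡ u) (step k ⟨$⟩ˡ v)) ≤ suc (suc (suc m) * q)
    cell-row u≢v = begin
      sum (λ k → occupancy (step k ⟨$⟩ˡ u) (step k ⟨$⟩ˡ v))        ≡⟨ sum-cong-≗ cell ⟩
      sum (λ k → count (λ c → inCell? u v (c ∘ₚ step k)) C) ≤⟨ packing-bound (inCell? u v) (atMost-two u≢v) [] [] [] [] ⟩
      m !                                                  ≡⟨ cell-size ⟩
      suc (suc (suc m) * q)                                ∎
      where
      open ≤-Reasoning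
      cell : ∀ k → occupancy (step k ⟨$⟩ˡ u) (step k ⟨$⟩ˡ v) ≡ count (λ c → inCell? u v (c ∘ₚ step k)) C
      cell k = trans
        (occupancy-off-diagonal λ eq → u≢v (trans (sym (step-⟨$⟩′ k refl)) (step-⟨$⟩′ k eq)))
        (count-≐ (inCell? _ _) (λ c → inCell? u v (c ∘ₚ step k))
          (λ { (eq₀ , eq₁) → step-⟨$⟩′ k eq₀ , step-⟨$⟩′ k eq₁ })
          (λ { (eq₀ , eq₁) → step-⟨$⟩ k eq₀ , step-⟨$⟩ k eq₁ }) C)
    by-cases : Dec (u ≡ v) → sum (λ k → occupancy (step k ⟨$⟩ˡ u) (step k ⟨$⟩ˡ v)) ≤ suc (suc (suc m) * q)
    by-cases (yes refl) = diagonal-row u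
    by-cases (no u≢v)   = cell-row u≢v

  occupancy-split : ∀ u v → occupancy u v ≡ count (inCell? u v) C + q * indicator (does (u Finₚ.≟ v))
  occupancy-split u v with u Finₚ.≟ v
  ... | no _     = sym (trans (cong (count (inCell? u v) C +_) (*-zeroʳ q)) (+-identityʳ _))
  ... | yes refl = sym (cong₂ _+_ (cong length (filter-none (inCell? u u) {xs = C} (All.universal empty C))) (*-identityʳ q))
    where
    empty : ∀ σ → ¬ InCell u u σ
    empty σ (eq₀ , eq₁) with trans (sym (inverseˡ σ)) (trans (cong (σ ⟨$⟩ˡ_) (trans eq₀ (sym eq₁))) (inverseˡ σ))
    ... | ()

  sum₂-occupancy : sum₂ occupancy ≡ length C + suc (suc m) * q
  sum₂-occupancy = begin
    sum₂ occupancy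
      ≡⟨ sum₂-cong occupancy-split ⟩
    sum₂ (λ u v → count (inCell? u v) C + q * indicator (does (u Finₚ.≟ v)))
      ≡⟨ sum₂-+ {suc (suc m)} (λ u v → count (inCell? u v) C) (λ u v → q * indicator (does (u Finₚ.≟ v))) ⟩
    sum₂ (λ u v → count (inCell? u v) C) + sum₂ {suc (suc m)} (λ u v → q * indicator (does (u Finₚ.≟ v)))
      ≡⟨ cong₂ _+_ (sym length-C) diagonal ⟩
    length C + suc (suc m) * q ∎
    where
    open ≡-Reasoning
    length-C : length C ≡ sum₂ (λ u v → count (inCell? u v) C)
    length-C = trans (length≡sum-count (_⟨$⟩ʳ zero) C) (sum-cong-≗ λ u →
      trans (length≡sum-count (_⟨$⟩ʳ suc zero) (filter (λ σ → σ ⟨$⟩ʳ zero Finₚ.≟ u) C)) (sum-cong-≗ λ v →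
        sym (count-×-dec (λ σ → σ ⟨$⟩ʳ zero Finₚ.≟ u) (λ σ → σ ⟨$⟩ʳ suc zero Finₚ.≟ v) C)))
    diagonal : sum₂ {suc (suc m)} (λ u v → q * indicator (does (u Finₚ.≟ v))) ≡ suc (suc m) * q
    diagonal = trans (sum-cong-≗ {suc (suc m)} λ u → trans
      (sym (*-distribˡ-sum q (λ v → indicator (does (u Finₚ.≟ v)))))
      (trans (cong (q *_) (sum-indicator-≟ u)) (*-identityʳ q))) (sum-const (suc (suc m)) q)

  -- The bound on all cells loses the share `q` of each diagonal cell, leaving the mean times the
  -- number of off-diagonal cells.
  length-bound : length C ≤ suc m * (suc (suc m) * q)
  length-bound = +-cancelˡ-≤ (suc (suc m) * q) _ _ (begin
    suc (suc m) * q + length C           ≡⟨ +-comm (suc (suc m) * q) (length C) ⟩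
    length C + suc (suc m) * q           ≡⟨ sum₂-occupancy ⟨
    sum₂ occupancy                       ≤⟨ Discharging.sum₂-bound occupancy q 8≤1+m many-fixed row ⟩
    suc (suc m) * (suc (suc m) * q)      ∎)
    where open ≤-Reasoning

many-fixed-11 : ∀ (u v : Fin 11) → 10 ≤ 3 + fixing u v
many-fixed-11 = from-yes (all? λ (u : Fin 11) → all? λ (v : Fin 11) → 10 ≤? 3 + fixing u v)

P≤-11 : P≤ 11 3 ((10 !) ∸ 10)
-- By Wilson's theorem `(n - 2)!` is 1 modulo a prime `n`; here `q = (9! - 1) / 11`, confirmed by
-- the last `refl`. The bound `10 * (11 * q)` evaluates to `10! - 10`.
P≤-11 C code = TwoPoint.length-bound C code 32989 (from-yes (8 ≤? 10)) many-fixed-11 refl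

many-fixed-13 : ∀ (u v : Fin 13) → 12 ≤ 3 + fixing u v
many-fixed-13 = from-yes (all? λ (u : Fin 13) → all? λ (v : Fin 13) → 12 ≤? 3 + fixing u v)

P≤-13 : P≤ 13 3 ((12 !) ∸ 12)
-- Here `q = (11! - 1) / 13`.
P≤-13 C code = TwoPoint.length-bound C code 3070523 (from-yes (8 ≤? 12)) many-fixed-13 refl

many-fixed-17 : ∀ (u v : Fin 17) → 16 ≤ 3 + fixing u v
many-fixed-17 = from-yes (all? λ (u : Fin 17) → all? λ (v : Fin 17) → 16 ≤? 3 + fixing u v)

P≤-17 : P≤ 17 3 ((16 !) ∸ 5)
P≤-17 C code = ≤-trans
  -- With `q = (15! - 1) / 17` the cells give `16! - 16`, which is then weakened.
  (TwoPoint.length-bound C code 76922021647 (from-yes (8 ≤? 16)) many-fixed-17 refl)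
  (∸-monoʳ-≤ {5} {16} (16 !) (from-yes (5 ≤? 16)))

-- Refutation of exact covers

Word : Set
Word = List ℕ

_==_ : Word → Word → Bool
[]       == []       = true
[]       == (_ ∷ _)  = false
(_ ∷ _)  == []       = false
(x ∷ xs) == (y ∷ ys) = (x ≡ᵇ y) ∧ (xs == ys)

==⇒≡ : ∀ xs ys → T (xs == ys) → xs ≡ ys
==⇒≡ []       []       _  = refl
==⇒≡ (x ∷ xs) (y ∷ ys) eq =
  let x≡y , xs≡ys = Equivalence.to T-∧ eq in cong₂ _∷_ (≡ᵇ⇒≡ x y x≡y) (==⇒≡ xs ys xs≡ys)

==-refl : ∀ xs → T (xs == xs)
==-refl []       = tt
==-refl (x ∷ xs) = Equivalence.from T-∧ (≡⇒≡ᵇ x x refl , ==-refl xs)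

ball : ℕ → Word → List Word
ball m w = w ∷ map (λ i → map (swapValue i) w) (upTo m)

_∈ᵇ_ : Word → List Word → Bool
w ∈ᵇ ws = any (w ==_) ws

∈ᵇ⇒∈ : ∀ w ws → T (w ∈ᵇ ws) → w ∈ ws
∈ᵇ⇒∈ w ws w∈ = Any.map (==⇒≡ w _) (any⁻ (w ==_) ws w∈)

-- A certificate lists the vertices to branch on, in depth-first order. At each of them every
-- codeword that could cover the vertex is tried, except those excluded by the choices made so far.
module Search (m : ℕ) (vertices missed : List Word) where

  -- Equal words are exempt, since one codeword may cover several branching vertices.
  conflict : Word → Word → Bool
  conflict c d = not (c == d) ∧ any (_∈ᵇ ball m d) (ball m c)

  dead : List Word → Word → Bool
  dead chosen c = any (_∈ᵇ ball m c) missed ∨ any (conflict c) chosen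

  at : List Word → ℕ → Maybe Word
  at []       _       = nothing
  at (w ∷ _)  zero    = just w
  at (_ ∷ ws) (suc i) = at ws i

  -- Success returns the unread rest of the certificate, which the next sibling continues. This rest
  -- is no structural subterm, so fuel bounds the depth of branching.
  refuteAt : ℕ → List Word → List ℕ → Maybe (List ℕ)
  refuteAll : ℕ → List Word → List Word → List ℕ → Maybe (List ℕ)

  refuteAt zero    _      _          = nothing
  refuteAt (suc _) _      []         = nothing
  refuteAt (suc f) chosen (i ∷ cert) with at vertices i
  ... | nothing = nothing
  ... | just v  = refuteAll f chosen (ball m v) cert

  refuteAll f chosen []       cert = just cert
  refuteAll f chosen (c ∷ cs) cert with dead chosen c
  ... | true  = refuteAll f chosen cs cert
  ... | false with refuteAt f (c ∷ chosen) cert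
  ...   | nothing    = nothing
  ...   | just cert′ = refuteAll f chosen cs cert′

  at-∈ : ∀ ws i {w} → at ws i ≡ just w → w ∈ ws
  at-∈ (w ∷ _)  zero    refl = here refl
  at-∈ (_ ∷ ws) (suc i) eq   = there (at-∈ ws i eq)

  module Soundness (X : Pred Word 0ℓ)
    (covered : ∀ {v} → v ∈ vertices → Any X (ball m v))
    (packed : ∀ {c d z} → X c → X d → z ∈ ball m c → z ∈ ball m d → c ≡ d)
    (avoided : ∀ {u c} → u ∈ missed → X c → ¬ (u ∈ ball m c)) where

    conflict-sound : ∀ {c d} → X c → X d → ¬ T (conflict c d)
    conflict-sound {c} {d} xc xd t with Equivalence.to T-∧ t
    ... | c≠d , meet with find (any⁻ (_∈ᵇ ball m d) (ball m c) meet)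
    ...   | z , z∈c , z∈d with packed xc xd z∈c (∈ᵇ⇒∈ z (ball m d) z∈d)
    ...     | refl = subst T (Equivalence.to T-not-≡ c≠d) (==-refl c)

    dead-sound : ∀ {chosen c} → All X chosen → X c → ¬ T (dead chosen c)
    dead-sound {chosen} {c} xs xc t with Equivalence.to T-∨ t
    ... | inj₁ missed-covered with find (any⁻ (_∈ᵇ ball m c) missed missed-covered)
    ...   | u , u∈ , u∈c = avoided u∈ xc (∈ᵇ⇒∈ u (ball m c) u∈c)
    dead-sound {chosen} {c} xs xc t | inj₂ clash with find (any⁻ (conflict c) chosen clash)
    ...   | d , d∈ , c#d = conflict-sound xc (All.lookup xs d∈) c#d

    -- Some word satisfying `X` lies in the ball of the branching vertex. It cannot be dead, so it
    -- was added to `chosen` and that branch was refuted.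
    refuteAt-sound : ∀ f chosen cert {rest} → refuteAt f chosen cert ≡ just rest → ¬ All X chosen
    refuteAll-sound : ∀ f chosen cs cert {rest} → refuteAll f chosen cs cert ≡ just rest →
                      All X chosen → ¬ Any X cs

    refuteAt-sound (suc f) chosen (i ∷ cert) eq xs with at vertices i in v-eq
    ... | just v = refuteAll-sound f chosen (ball m v) cert eq xs (covered (at-∈ vertices i v-eq))

    refuteAll-sound f chosen (c ∷ cs) cert eq xs x∈ with dead chosen c in dead-eq
    refuteAll-sound f chosen (c ∷ cs) cert eq xs (here xc) | true =
      dead-sound xs xc (subst T (sym dead-eq) tt)
    refuteAll-sound f chosen (c ∷ cs) cert eq xs (there x∈) | true =
      refuteAll-sound f chosen cs cert eq xs x∈
    refuteAll-sound f chosen (c ∷ cs) cert eq xs x∈ | false with refuteAt f (c ∷ chosen) cert in at-eq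
    refuteAll-sound f chosen (c ∷ cs) cert eq xs (here xc) | false | just cert′ =
      refuteAt-sound f (c ∷ chosen) cert at-eq (xc ∷ xs)
    refuteAll-sound f chosen (c ∷ cs) cert eq xs (there x∈) | false | just cert′ =
      refuteAll-sound f chosen cs cert′ eq xs x∈

-- Permutations as words

wordOf : Permutation′ n → Word
wordOf σ = tabulate (λ x → toℕ (σ ⟨$⟩ʳ x))

wordOf-cong : {σ τ : Permutation′ n} → σ ≈ₚ τ → wordOf σ ≡ wordOf τ
wordOf-cong eq = tabulate-cong (cong toℕ ∘ eq)

tabulate-injective : {f g : Fin n → A} → tabulate f ≡ tabulate g → ∀ x → f x ≡ g x
tabulate-injective eq zero    = proj₁ (∷-injective eq)
tabulate-injective eq (suc x) = tabulate-injective (proj₂ (∷-injective eq)) x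

wordOf-injective : (σ τ : Permutation′ n) → wordOf σ ≡ wordOf τ → σ ≈ₚ τ
wordOf-injective σ τ eq x = toℕ-injective (tabulate-injective eq x)

wordOf-step : (σ : Permutation′ (suc m)) (i : Fin m) →
              wordOf (σ ∘ₚ step (suc i)) ≡ map (swapValue (toℕ i)) (wordOf σ)
wordOf-step σ i = trans (tabulate-cong λ x → toℕ-step i (σ ⟨$⟩ʳ x))
  (sym (map-tabulate (λ x → toℕ (σ ⟨$⟩ʳ x)) (swapValue (toℕ i))))

∈-ball⁺ : (σ : Permutation′ (suc m)) (k : Fin (suc m)) → wordOf (σ ∘ₚ step k) ∈ ball m (wordOf σ)
∈-ball⁺ σ zero    = here refl
∈-ball⁺ {m} σ (suc i) = there (subst (_∈ map (λ j → map (swapValue j) (wordOf σ)) (upTo m)) (sym (wordOf-step σ i))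
  (∈-map⁺ (λ j → map (swapValue j) (wordOf σ)) (∈-upTo⁺ (toℕ<n i))))

∈-ball⁻ : (σ : Permutation′ (suc m)) {z : Word} → z ∈ ball m (wordOf σ) →
          ∃ λ k → z ≡ wordOf (σ ∘ₚ step k)
∈-ball⁻ σ (here refl) = zero , refl
∈-ball⁻ σ (there z∈) with ∈-map⁻ _ z∈
... | i , i∈ , refl = suc (fromℕ< i<m) ,
  sym (trans (wordOf-step σ (fromℕ< i<m)) (cong (λ j → map (swapValue j) (wordOf σ)) (toℕ-fromℕ< i<m)))
  where i<m = ∈-upTo⁻ i∈

-- The head is applied last, in contrast to `prod`; `word` computes the same permutation as a list.
act : List (Fin m) → Permutation′ (suc m)
act []       = id
act (g ∷ gs) = act gs ∘ₚ step (suc g)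

word : List (Fin m) → Word
word {m} = foldr (λ g → map (swapValue (toℕ g))) (upTo (suc m))

tabulate-toℕ : ∀ n (f : ℕ → A) → tabulate {n = n} (f ∘ toℕ) ≡ applyUpTo f n
tabulate-toℕ zero    f = refl
tabulate-toℕ (suc n) f = cong (f 0 ∷_) (tabulate-toℕ n (f ∘ suc))

wordOf-act : (h : List (Fin m)) → wordOf (act h) ≡ word h
wordOf-act {m} []       = tabulate-toℕ (suc m) (λ x → x)
wordOf-act     (g ∷ gs) = trans (wordOf-step (act gs) g) (cong (map (swapValue (toℕ g))) (wordOf-act gs))

Refutes : (hs missed chosen : List (List (Fin m))) → List ℕ → Set
Refutes {m} hs missed chosen cert =
  Search.refuteAt m (map word hs) (map word missed) (length cert) (map word chosen) cert ≡ just []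

-- Transfer of searches to arbitrary cosets

module Refutation (C : List (Permutation′ (suc m))) (code : IsCode 3 C) (b : Permutation′ (suc m)) where
  open Code C code

  -- Right multiplication by the inverse of `b` commutes with the steps, hence preserves balls, and
  -- moves `b` to the identity. One search around the identity therefore serves every `b`.
  relative : Permutation′ (suc m) → Permutation′ (suc m)
  relative c = flip b ∘ₚ c

  X : Pred Word 0ℓ
  X w = ∃ λ c → c ∈ C × w ≡ wordOf (relative c)

  relative-∘ : ∀ {c} h → c ≈ₚ (b ∘ₚ act h) → relative c ≈ₚ act h
  relative-∘ h eq x = trans (eq (b ⟨$⟩ˡ x)) (cong (act h ⟨$⟩ʳ_) (inverseʳ b))

  covered⇒ball : ∀ h → Covered (b ∘ₚ act h) → Any X (ball m (word h))
  covered⇒ball h cov with find cov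
  ... | c , c∈ , k , eq = lose (subst₂ (λ w v → w ∈ ball m v) (wordOf-cong {σ = act h ∘ₚ step k} {relative c} near)
                                  (wordOf-act h) (∈-ball⁺ (act h) k))
                               (c , c∈ , refl)
    where
    near : (act h ∘ₚ step k) ≈ₚ relative c
    near x = begin
      step k ⟨$⟩ʳ (act h ⟨$⟩ʳ x)                            ≡⟨ cong (λ y → step k ⟨$⟩ʳ (act h ⟨$⟩ʳ y)) (inverseʳ b) ⟨
      step k ⟨$⟩ʳ (act h ⟨$⟩ʳ (b ⟨$⟩ʳ (b ⟨$⟩ˡ x)))          ≡⟨ cong (step k ⟨$⟩ʳ_) (eq (b ⟨$⟩ˡ x)) ⟨
      step k ⟨$⟩ʳ (step k ⟨$⟩ʳ (relative c ⟨$⟩ʳ x))         ≡⟨ step-involutive k _ ⟩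
      relative c ⟨$⟩ʳ x                                     ∎
      where open ≡-Reasoning

  unrelative : ∀ {c d} → relative c ≈ₚ relative d → c ≈ₚ d
  unrelative {c} {d} eq x = subst (λ y → c ⟨$⟩ʳ y ≡ d ⟨$⟩ʳ y) (inverseˡ b) (eq (b ⟨$⟩ʳ x))

  packed : ∀ {c d z} → X c → X d → z ∈ ball m c → z ∈ ball m d → c ≡ d
  packed (c , c∈ , refl) (d , d∈ , refl) z∈c z∈d with ∈-ball⁻ (relative c) z∈c | ∈-ball⁻ (relative d) z∈d
  ... | k , eq₁ | l , eq₂ = cong (wordOf ∘ relative) (balls-disjoint k l c∈ d∈
    (unrelative {c ∘ₚ step k} {d ∘ₚ step l}
      (wordOf-injective (relative c ∘ₚ step k) (relative d ∘ₚ step l) (trans (sym eq₁) eq₂))))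

  ball⇒covered : ∀ h {c} → X c → word h ∈ ball m c → Covered (b ∘ₚ act h)
  ball⇒covered h (c , c∈ , refl) h∈ with ∈-ball⁻ (relative c) h∈
  ... | k , eq = lose {P = Covers (b ∘ₚ act h)} c∈ (k , λ x →
    trans (cong (λ y → step k ⟨$⟩ʳ (c ⟨$⟩ʳ y)) (sym (inverseˡ b)))
      (wordOf-injective (relative c ∘ₚ step k) (act h) (trans (sym eq) (sym (wordOf-act h))) (b ⟨$⟩ʳ x)))

  refute : ∀ hs missed chosen cert → Refutes hs missed chosen cert →
           All (λ h → ¬ Covered (b ∘ₚ act h)) missed →
           All (λ h → Any (_≈ₚ (b ∘ₚ act h)) C) chosen →
           ¬ All (λ h → Covered (b ∘ₚ act h)) hs
  refute hs missed chosen cert eq uncovered codewords covered =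
    Search.Soundness.refuteAt-sound m (map word hs) (map word missed) X
      covered-word packed avoided (length cert) (map word chosen) cert eq
      (Allₚ.map⁺ (All.map (λ {h} → codeword-word h) codewords))
    where
    covered-word : ∀ {v} → v ∈ map word hs → Any X (ball m v)
    covered-word v∈ with ∈-map⁻ word v∈
    ... | h , h∈ , refl = covered⇒ball h (All.lookup covered h∈)
    avoided : ∀ {u c} → u ∈ map word missed → X c → ¬ (u ∈ ball m c)
    avoided u∈ xc u∈c with ∈-map⁻ word u∈
    ... | h , h∈ , refl = All.lookup uncovered h∈ (ball⇒covered h xc u∈c)
    codeword-word : ∀ h → Any (_≈ₚ (b ∘ₚ act h)) C → X (word h)
    codeword-word h c∈ with find c∈
    ... | c , c∈C , eq = c , c∈C , trans (sym (wordOf-act h)) (sym (wordOf-cong {σ = relative c} {act h} (relative-∘ {c} h eq)))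

-- Uncovered permutations in cosets

module Cosets (C : List (Permutation′ (suc m))) (code : IsCode 3 C) (P : Pred (Permutation′ (suc m)) 0ℓ) where

  open Code C code

  uncovered-among : ∀ hs b → All (λ h → P (b ∘ₚ act h)) hs → ¬ All (λ h → Covered (b ∘ₚ act h)) hs →
                    ∃ λ h → h ∈ hs × P (b ∘ₚ act h) × ¬ Covered (b ∘ₚ act h)
  uncovered-among hs b all-P ¬all with find (Allₚ.¬All⇒Any¬ (λ h → covered? (b ∘ₚ act h)) hs ¬all)
  ... | h , h∈ , ¬cov = h , h∈ , All.lookup all-P h∈ , ¬cov

  -- If the coset were covered, some codeword would cover `b`. Either it lies outside, reached by
  -- the step `suc g` that leaves the coset, and the external certificate applies at `b`; or it lies
  -- in the coset, and the codeword certificate applies after recentring there.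
  uncovered-exists : ∀ hs g codeword-cert external-cert → [] ∈ hs →
                     Refutes hs [] ([] ∷ []) codeword-cert →
                     Refutes hs [] ((g ∷ []) ∷ []) external-cert →
                     (∀ b → P b → All (λ h → P (b ∘ₚ act h)) hs) →
                     (∀ b c k → k ≢ suc g → (c ∘ₚ step k) ≈ₚ b → P b → P c) →
                     ∀ b → P b → ∃ λ u → P u × ¬ Covered u
  uncovered-exists hs g codeword-cert external-cert e∈hs codeword-refuted external-refuted P-act P-step b pb
    with All.all? (λ h → covered? (b ∘ₚ act h)) hs
  ... | no ¬all = let h , _ , ph , ¬cov = uncovered-among hs b (P-act b pb) ¬all in b ∘ₚ act h , ph , ¬cov
  ... | yes all with find (All.lookup all e∈hs)
  ...   | c , c∈ , k , eq with k Finₚ.≟ suc g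
  ...     | yes refl = contradiction all
    (Refutation.refute C code b hs [] ((g ∷ []) ∷ []) external-cert external-refuted []
      (lose {P = _≈ₚ (b ∘ₚ act (g ∷ []))} c∈
        (λ x → trans (sym (step-involutive (suc g) _)) (cong (step (suc g) ⟨$⟩ʳ_) (eq x))) ∷ []))
  ...     | no k≢g with All.all? (λ h → covered? (c ∘ₚ act h)) hs
  ...       | no ¬all = let h , _ , ph , ¬cov = uncovered-among hs c (P-act c (P-step b c k k≢g eq pb)) ¬all
                        in c ∘ₚ act h , ph , ¬cov
  ...       | yes all′ = contradiction all′
    (Refutation.refute C code c hs [] ([] ∷ []) codeword-cert codeword-refuted []
      (lose {P = _≈ₚ (c ∘ₚ act [])} c∈ (λ _ → refl) ∷ []))

  -- The search is centred at the known uncovered `u`, which no codeword may cover. The new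
  -- permutation differs from `u` because its `h` is not the identity.
  another-uncovered : ∀ hs cert → Refutes hs ([] ∷ []) [] cert →
                      All (λ h → ¬ (∀ x → act h ⟨$⟩ʳ x ≡ x)) hs →
                      ∀ u → All (λ h → P (u ∘ₚ act h)) hs → ¬ Covered u →
                      ∃ λ w → P w × ¬ Covered w × ¬ (u ≈ₚ w)
  another-uncovered hs cert refuted moves u all-P ¬cov with All.all? (λ h → covered? (u ∘ₚ act h)) hs
  ... | yes all = contradiction all (Refutation.refute C code u hs ([] ∷ []) [] cert refuted (¬cov ∷ []) [])
  ... | no ¬all with uncovered-among hs u all-P ¬all
  ...   | h , h∈ , ph , ¬cov′ = u ∘ₚ act h , ph , ¬cov′ , λ eq → All.lookup moves h∈ λ x →
    trans (cong (act h ⟨$⟩ʳ_) (sym (inverseʳ u))) (trans (sym (eq (u ⟨$⟩ˡ x))) (inverseʳ u))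

-- For a chain of adjacent transpositions, last one first: one word per element of the group they generate.
reducedWords : List A → List (List A)
reducedWords []       = [] ∷ []
reducedWords (g ∷ gs) = concatMap (λ r → map (r ++_) (reducedWords gs)) (tails (reverse (g ∷ gs)))

-- Reversed so that the identity comes first; certificate entries are positions in this order.
S₅ : List (List (Fin 5))
S₅ = reverse (reducedWords (3F ∷ 2F ∷ 1F ∷ 0F ∷ []))

S₄×S₃ : List (List (Fin 6))
S₄×S₃ = reverse (concatMap (λ h → map (h ++_) (reducedWords (5F ∷ 4F ∷ []))) (reducedWords (2F ∷ 1F ∷ 0F ∷ [])))

-- For a codeword at the identity.
codeword-cert₆ : List ℕ
codeword-cert₆ =
   25 ∷ 5 ∷ 59 ∷ 53 ∷ 28 ∷ 101 ∷ 57 ∷ 33 ∷ 81 ∷ 57 ∷ 33 ∷ 41 ∷ 83 ∷ 107 ∷ 4 ∷ 11 ∷ 17 ∷ 9 ∷ 54 ∷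
   96 ∷ 86 ∷ 30 ∷ 36 ∷ 31 ∷ 110 ∷ 62 ∷ 80 ∷ 97 ∷ 98 ∷ 100 ∷ 74 ∷ 30 ∷ 31 ∷ 79 ∷ 78 ∷ 27 ∷ 26 ∷
   48 ∷ 49 ∷ 96 ∷ 72 ∷ 49 ∷ 48 ∷ 73 ∷ []

-- For the identity covered from outside, by the codeword exchanging the values 4 and 5.
external-cert₆ : List ℕ
external-cert₆ =
   6 ∷ 30 ∷ 18 ∷ 38 ∷ 10 ∷ 26 ∷ 24 ∷ 50 ∷ 2 ∷ 4 ∷ 16 ∷ 68 ∷ 8 ∷ 46 ∷ 19 ∷ 20 ∷ 22 ∷ 14 ∷ 25 ∷ 24 ∷
   4 ∷ 12 ∷ 32 ∷ 60 ∷ 36 ∷ 56 ∷ 38 ∷ 26 ∷ 72 ∷ 49 ∷ 49 ∷ 24 ∷ 27 ∷ 54 ∷ 36 ∷ 12 ∷ 60 ∷ 55 ∷ 78 ∷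
   102 ∷ 36 ∷ 37 ∷ 2 ∷ 8 ∷ 26 ∷ 50 ∷ 52 ∷ 29 ∷ 24 ∷ 1 ∷ 4 ∷ 32 ∷ 56 ∷ 38 ∷ 62 ∷ 7 ∷ 12 ∷ 18 ∷ 2 ∷
   1 ∷ 3 ∷ 4 ∷ 1 ∷ []

-- For an uncovered identity; entries are positions in `S₅∖e`, hence shifted by one from `S₅`.
uncovered-cert₆ : List ℕ
uncovered-cert₆ =
   1 ∷ 25 ∷ 79 ∷ 57 ∷ 81 ∷ 33 ∷ 31 ∷ 57 ∷ 103 ∷ 33 ∷ 43 ∷ 37 ∷ 57 ∷ 103 ∷ 31 ∷ 7 ∷ 33 ∷ 19 ∷ 67 ∷
   59 ∷ 83 ∷ 35 ∷ 39 ∷ 49 ∷ 23 ∷ 47 ∷ 28 ∷ 51 ∷ 99 ∷ 75 ∷ 51 ∷ 73 ∷ 97 ∷ 28 ∷ 23 ∷ 33 ∷ 21 ∷ 70 ∷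
   69 ∷ 43 ∷ 117 ∷ 64 ∷ 88 ∷ 40 ∷ 64 ∷ 40 ∷ 44 ∷ 118 ∷ 94 ∷ 19 ∷ 22 ∷ 20 ∷ 16 ∷ 25 ∷ 49 ∷ 27 ∷
   23 ∷ 55 ∷ 37 ∷ 39 ∷ 81 ∷ 57 ∷ 57 ∷ 39 ∷ 63 ∷ 37 ∷ 103 ∷ 79 ∷ 3 ∷ 26 ∷ 32 ∷ 8 ∷ 0 ∷ 20 ∷ 34 ∷
   58 ∷ 40 ∷ 58 ∷ 80 ∷ 104 ∷ 34 ∷ 44 ∷ 38 ∷ 24 ∷ 50 ∷ 74 ∷ 52 ∷ 39 ∷ 31 ∷ 57 ∷ 55 ∷ 37 ∷ 57 ∷ 55 ∷
   105 ∷ 81 ∷ 57 ∷ 51 ∷ 31 ∷ 45 ∷ 55 ∷ 99 ∷ 111 ∷ 88 ∷ 112 ∷ 115 ∷ 109 ∷ 91 ∷ 79 ∷ 9 ∷ 4 ∷ 10 ∷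
   28 ∷ 52 ∷ 51 ∷ 50 ∷ 24 ∷ 7 ∷ 15 ∷ 21 ∷ 4 ∷ 43 ∷ 17 ∷ 41 ∷ 59 ∷ 89 ∷ 113 ∷ 55 ∷ 79 ∷ 101 ∷ 95 ∷
   73 ∷ 45 ∷ 67 ∷ 91 ∷ 61 ∷ 7 ∷ 31 ∷ 19 ∷ 35 ∷ 6 ∷ 12 ∷ 21 ∷ 22 ∷ 16 ∷ 65 ∷ 67 ∷ 59 ∷ 115 ∷ 45 ∷
   21 ∷ 17 ∷ 11 ∷ 25 ∷ 51 ∷ 73 ∷ 97 ∷ 27 ∷ 24 ∷ 37 ∷ 39 ∷ 57 ∷ 55 ∷ 105 ∷ 81 ∷ 55 ∷ 79 ∷ 57 ∷ 43 ∷
   9 ∷ 59 ∷ 109 ∷ 35 ∷ 71 ∷ 95 ∷ 47 ∷ 41 ∷ 29 ∷ 115 ∷ 103 ∷ 105 ∷ 79 ∷ 41 ∷ 89 ∷ 83 ∷ 35 ∷ 45 ∷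
   9 ∷ 67 ∷ 91 ∷ 61 ∷ 9 ∷ 13 ∷ 19 ∷ 45 ∷ 22 ∷ 46 ∷ 64 ∷ 94 ∷ 118 ∷ 40 ∷ 38 ∷ 43 ∷ 69 ∷ 93 ∷ 63 ∷
   []

codeword-cert₇ : List ℕ
codeword-cert₇ =
   38 ∷ 4 ∷ 3 ∷ 10 ∷ 43 ∷ 5 ∷ 37 ∷ 26 ∷ 48 ∷ 86 ∷ 84 ∷ 48 ∷ 32 ∷ 55 ∷ 57 ∷ 30 ∷ 62 ∷ 120 ∷ 86 ∷
   73 ∷ 75 ∷ 89 ∷ 88 ∷ 110 ∷ 108 ∷ 47 ∷ 82 ∷ 40 ∷ 37 ∷ 79 ∷ 39 ∷ 81 ∷ 114 ∷ 78 ∷ 22 ∷ 23 ∷ 20 ∷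
   32 ∷ 26 ∷ 68 ∷ 104 ∷ 106 ∷ 102 ∷ 107 ∷ 143 ∷ 141 ∷ 69 ∷ 5 ∷ 40 ∷ 89 ∷ 118 ∷ 83 ∷ 82 ∷ 83 ∷ 82 ∷
   125 ∷ 124 ∷ 123 ∷ 72 ∷ 65 ∷ 53 ∷ 73 ∷ 53 ∷ 50 ∷ 84 ∷ 124 ∷ 122 ∷ 76 ∷ 82 ∷ 83 ∷ 119 ∷ 116 ∷
   78 ∷ 11 ∷ 10 ∷ 7 ∷ 13 ∷ 37 ∷ 27 ∷ 24 ∷ 43 ∷ 45 ∷ 79 ∷ 73 ∷ 10 ∷ 11 ∷ 5 ∷ 43 ∷ 47 ∷ 82 ∷ 40 ∷
   39 ∷ 37 ∷ 16 ∷ 17 ∷ 26 ∷ 14 ∷ 22 ∷ 16 ∷ 40 ∷ 26 ∷ 14 ∷ 16 ∷ 20 ∷ 32 ∷ 35 ∷ 21 ∷ 7 ∷ 40 ∷ 82 ∷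
   76 ∷ 74 ∷ 39 ∷ 37 ∷ 40 ∷ 39 ∷ 16 ∷ 10 ∷ 23 ∷ 22 ∷ 10 ∷ 82 ∷ 118 ∷ 119 ∷ 95 ∷ 94 ∷ 45 ∷ 43 ∷
   47 ∷ 45 ∷ 43 ∷ 82 ∷ 77 ∷ 76 ∷ 10 ∷ 23 ∷ 22 ∷ 84 ∷ 73 ∷ 37 ∷ 109 ∷ 115 ∷ 114 ∷ 78 ∷ 119 ∷ 112 ∷
   109 ∷ 43 ∷ 37 ∷ 109 ∷ 115 ∷ 117 ∷ 114 ∷ 116 ∷ 112 ∷ 40 ∷ 109 ∷ 43 ∷ 122 ∷ 120 ∷ 124 ∷ 50 ∷ 89 ∷
   50 ∷ 48 ∷ 120 ∷ 89 ∷ 53 ∷ 52 ∷ 120 ∷ 48 ∷ 60 ∷ 14 ∷ 52 ∷ 89 ∷ 88 ∷ 16 ∷ 28 ∷ 8 ∷ 53 ∷ 89 ∷ 88 ∷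
   48 ∷ 122 ∷ 124 ∷ 125 ∷ 89 ∷ 88 ∷ 77 ∷ 75 ∷ 111 ∷ 109 ∷ 112 ∷ 40 ∷ 134 ∷ 132 ∷ 44 ∷ 42 ∷ 72 ∷
   74 ∷ 112 ∷ 76 ∷ 40 ∷ 76 ∷ 40 ∷ 39 ∷ 75 ∷ 73 ∷ 110 ∷ 74 ∷ 42 ∷ 43 ∷ 72 ∷ 74 ∷ 73 ∷ 37 ∷ 39 ∷
   80 ∷ 74 ∷ 72 ∷ 8 ∷ 20 ∷ 18 ∷ 44 ∷ 74 ∷ 110 ∷ 108 ∷ 72 ∷ 73 ∷ 75 ∷ 39 ∷ 37 ∷ 112 ∷ 113 ∷ 89 ∷
   85 ∷ 123 ∷ 121 ∷ 125 ∷ 124 ∷ 119 ∷ 118 ∷ 110 ∷ 108 ∷ 72 ∷ 84 ∷ 86 ∷ 73 ∷ 75 ∷ 39 ∷ 37 ∷ 85 ∷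
   121 ∷ 60 ∷ 75 ∷ 39 ∷ 37 ∷ 42 ∷ 43 ∷ 45 ∷ 39 ∷ 37 ∷ 5 ∷ 3 ∷ 7 ∷ 27 ∷ 13 ∷ 11 ∷ 10 ∷ 78 ∷ 80 ∷
   74 ∷ 110 ∷ 72 ∷ 80 ∷ 74 ∷ 72 ∷ 108 ∷ 112 ∷ 77 ∷ []

-- Here the outside codeword exchanges the values 3 and 4, the one adjacent transposition missing
-- from `S₄×S₃`.
external-cert₇ : List ℕ
external-cert₇ =
   2 ∷ 38 ∷ 36 ∷ 42 ∷ 46 ∷ 40 ∷ 37 ∷ 43 ∷ 40 ∷ 43 ∷ 37 ∷ 40 ∷ 47 ∷ 46 ∷ 9 ∷ 11 ∷ 4 ∷ 35 ∷ 22 ∷ 1 ∷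
   3 ∷ 40 ∷ 77 ∷ 47 ∷ 82 ∷ 81 ∷ 118 ∷ 80 ∷ 42 ∷ 116 ∷ 117 ∷ 115 ∷ 112 ∷ 47 ∷ 5 ∷ 4 ∷ 3 ∷ 15 ∷ 9 ∷
   36 ∷ 42 ∷ 40 ∷ 46 ∷ 43 ∷ 37 ∷ 37 ∷ 43 ∷ 40 ∷ 47 ∷ 46 ∷ 9 ∷ 11 ∷ 4 ∷ 22 ∷ 35 ∷ 1 ∷ 3 ∷ 42 ∷ 72 ∷
   12 ∷ 18 ∷ 9 ∷ 14 ∷ 3 ∷ 14 ∷ 12 ∷ 16 ∷ 5 ∷ 13 ∷ 25 ∷ 7 ∷ 17 ∷ 29 ∷ 13 ∷ 52 ∷ 64 ∷ 88 ∷ 5 ∷ 17 ∷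
   16 ∷ 12 ∷ 16 ∷ 5 ∷ 13 ∷ 17 ∷ 34 ∷ 23 ∷ 22 ∷ 13 ∷ 3 ∷ 1 ∷ 49 ∷ 27 ∷ 18 ∷ 31 ∷ 5 ∷ 17 ∷ 16 ∷ 8 ∷
   6 ∷ 7 ∷ 1 ∷ 10 ∷ 11 ∷ 4 ∷ 1 ∷ 10 ∷ 4 ∷ 5 ∷ 42 ∷ 44 ∷ 36 ∷ 38 ∷ 11 ∷ 10 ∷ 4 ∷ 11 ∷ 45 ∷ 39 ∷
   37 ∷ 36 ∷ 38 ∷ 10 ∷ 11 ∷ 6 ∷ 4 ∷ 10 ∷ 7 ∷ 1 ∷ 3 ∷ 24 ∷ 25 ∷ 49 ∷ 21 ∷ 33 ∷ 10 ∷ 7 ∷ 1 ∷ 9 ∷ 4 ∷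
   5 ∷ 11 ∷ 10 ∷ 45 ∷ 47 ∷ 40 ∷ 36 ∷ 39 ∷ 119 ∷ 82 ∷ 37 ∷ 39 ∷ 38 ∷ 40 ∷ 41 ∷ 47 ∷ 77 ∷ 112 ∷ 37 ∷
   36 ∷ 6 ∷ 44 ∷ 1 ∷ 9 ∷ 45 ∷ 75 ∷ 73 ∷ 113 ∷ 3 ∷ 15 ∷ 13 ∷ 44 ∷ 42 ∷ 6 ∷ 36 ∷ 40 ∷ 47 ∷ 1 ∷ 9 ∷
   1 ∷ 7 ∷ 9 ∷ 47 ∷ 45 ∷ 37 ∷ 117 ∷ 79 ∷ 41 ∷ 40 ∷ 8 ∷ 6 ∷ 10 ∷ 5 ∷ 14 ∷ 16 ∷ 12 ∷ 4 ∷ 6 ∷ 14 ∷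
   12 ∷ 13 ∷ 1 ∷ 25 ∷ 1 ∷ 25 ∷ 5 ∷ 17 ∷ 16 ∷ 12 ∷ 24 ∷ 18 ∷ 12 ∷ 14 ∷ 42 ∷ 80 ∷ 78 ∷ 8 ∷ 14 ∷ 38 ∷
   44 ∷ 74 ∷ 110 ∷ 42 ∷ 6 ∷ 74 ∷ 80 ∷ 92 ∷ 72 ∷ 76 ∷ 41 ∷ 6 ∷ 7 ∷ 9 ∷ 1 ∷ 3 ∷ 14 ∷ 12 ∷ 13 ∷ 25 ∷
   31 ∷ 61 ∷ 97 ∷ 99 ∷ 1 ∷ 96 ∷ 51 ∷ 52 ∷ 64 ∷ 43 ∷ 47 ∷ 41 ∷ 37 ∷ 39 ∷ 37 ∷ 39 ∷ 24 ∷ 12 ∷ 14 ∷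
   18 ∷ 30 ∷ 20 ∷ 12 ∷ 18 ∷ 20 ∷ 32 ∷ 11 ∷ 23 ∷ 33 ∷ 31 ∷ []


S₅∖e : List (List (Fin 5))
S₅∖e = drop 1 S₅

-- Six points

codeword-refuted₆ : Refutes S₅ [] ([] ∷ []) codeword-cert₆
codeword-refuted₆ = refl

external-refuted₆ : Refutes S₅ [] ((4F ∷ []) ∷ []) external-cert₆
external-refuted₆ = refl

uncovered-refuted₆ : Refutes S₅∖e ([] ∷ []) [] uncovered-cert₆
uncovered-refuted₆ = refl

act-fixes-top : All (λ h → act h ⟨$⟩ʳ 5F ≡ 5F) S₅
act-fixes-top = from-yes (All.all? (λ h → act h ⟨$⟩ʳ 5F Finₚ.≟ 5F) S₅)

act-moves : All (λ h → ¬ (∀ x → act h ⟨$⟩ʳ x ≡ x)) S₅∖e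
act-moves = from-yes (All.all? (λ h → ¬? (all? λ x → act h ⟨$⟩ʳ x Finₚ.≟ x)) S₅∖e)

step-fixes-top : ∀ (k : Fin 6) → k ≢ 5F → step k ⟨$⟩ʳ 5F ≡ 5F
step-fixes-top 0F _   = refl
step-fixes-top 1F _   = refl
step-fixes-top 2F _   = refl
step-fixes-top 3F _   = refl
step-fixes-top 4F _   = refl
step-fixes-top 5F k≢5 = contradiction refl k≢5

infeasible : ∀ {l x y r} → l ≤ x → x ≡ y → y ≤ r → ¬ (r < l)
infeasible l≤x refl x≤r = ≤⇒≯ (≤-trans l≤x x≤r)

-- Quantities bounded below are collected on the left and those bounded above on the right. The
-- bound on `a₅` changes sides between the two identities.
many-identity : ∀ a₀ a₁ a₂ a₃ a₄ a₅ →
  19 * (a₀ + a₁ + a₂ + a₃ + a₄ + a₅) + 41 * (5 * a₅ + 3 * a₄ + a₃) + 411 * a₅ ≡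
  3 * (5 * a₀ + a₁) + 4 * (a₀ + 4 * a₁ + a₂) + 15 * (a₂ + 4 * a₃ + a₄) + 127 * (a₄ + 5 * a₅)
many-identity = solve-∀
few-identity : ∀ a₀ a₁ a₂ a₃ a₄ a₅ →
  19 * (a₀ + a₁ + a₂ + a₃ + a₄ + a₅) + 168 * (5 * a₅ + 3 * a₄ + a₃) ≡
  3 * (5 * a₀ + a₁) + 4 * (a₀ + 4 * a₁ + a₂) + 15 * (a₂ + 4 * a₃ + a₄) + 127 * (a₃ + 4 * a₄ + a₅) + 732 * a₅
few-identity = solve-∀

-- Branch and bound on a₅; the multipliers are Farkas certificates for the two branches.
infeasible-many : ∀ a₀ a₁ a₂ a₃ a₄ a₅ → 5 * a₀ + a₁ ≤ 120 → a₀ + 4 * a₁ + a₂ ≤ 120 → a₂ + 4 * a₃ + a₄ ≤ 120 →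
  a₄ + 5 * a₅ ≤ 118 → 117 ≤ a₀ + a₁ + a₂ + a₃ + a₄ + a₅ →
  176 ≤ 5 * a₅ + 3 * a₄ + a₃ → 20 ≤ a₅ → ¬ (17626 < 17659)
infeasible-many a₀ a₁ a₂ a₃ a₄ a₅ r₀ r₁ r₃ r₅ total heavy 20≤a₅ = infeasible
  (+-mono-≤ (+-mono-≤ (*-monoʳ-≤ 19 total) (*-monoʳ-≤ 41 heavy)) (*-monoʳ-≤ 411 20≤a₅))
  (many-identity a₀ a₁ a₂ a₃ a₄ a₅)
  (+-mono-≤ (+-mono-≤ (+-mono-≤ (*-monoʳ-≤ 3 r₀) (*-monoʳ-≤ 4 r₁)) (*-monoʳ-≤ 15 r₃)) (*-monoʳ-≤ 127 r₅))

infeasible-few : ∀ a₀ a₁ a₂ a₃ a₄ a₅ → 5 * a₀ + a₁ ≤ 120 → a₀ + 4 * a₁ + a₂ ≤ 120 → a₂ + 4 * a₃ + a₄ ≤ 120 →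
  a₃ + 4 * a₄ + a₅ ≤ 120 → 117 ≤ a₀ + a₁ + a₂ + a₃ + a₄ + a₅ →
  176 ≤ 5 * a₅ + 3 * a₄ + a₃ → a₅ ≤ 19 → ¬ (31788 < 31791)
infeasible-few a₀ a₁ a₂ a₃ a₄ a₅ r₀ r₁ r₃ r₄ total heavy a₅≤19 = infeasible
  (+-mono-≤ (*-monoʳ-≤ 19 total) (*-monoʳ-≤ 168 heavy))
  (few-identity a₀ a₁ a₂ a₃ a₄ a₅)
  (+-mono-≤ (+-mono-≤ (+-mono-≤ (+-mono-≤ (*-monoʳ-≤ 3 r₀) (*-monoʳ-≤ 4 r₁)) (*-monoʳ-≤ 15 r₃)) (*-monoʳ-≤ 127 r₄))
    (*-monoʳ-≤ 732 a₅≤19))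

-- The target 175 is the largest integer whose sixfold stays below `9 * 117 = 1053`.
weighted-bound : ∀ a₀ a₁ a₂ a₃ a₄ a₅ → 5 * a₀ + a₁ ≤ 120 → a₀ + 4 * a₁ + a₂ ≤ 120 → a₂ + 4 * a₃ + a₄ ≤ 120 →
  a₃ + 4 * a₄ + a₅ ≤ 120 → a₄ + 5 * a₅ ≤ 118 → 117 ≤ a₀ + a₁ + a₂ + a₃ + a₄ + a₅ →
  5 * a₅ + 3 * a₄ + a₃ ≤ 175
weighted-bound a₀ a₁ a₂ a₃ a₄ a₅ r₀ r₁ r₃ r₄ r₅ total = ≮⇒≥ λ heavy →
  [ (λ 20≤a₅ → infeasible-many a₀ a₁ a₂ a₃ a₄ a₅ r₀ r₁ r₃ r₅ total heavy 20≤a₅ (from-yes (17626 <? 17659)))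
  , (λ a₅<20 → infeasible-few a₀ a₁ a₂ a₃ a₄ a₅ r₀ r₁ r₃ r₄ total heavy (s≤s⁻¹ a₅<20) (from-yes (31788 <? 31791)))
  ]′ (≤-<-connex 20 a₅)

weighted-count : (a : Fin 6 → ℕ) → (∀ v → sum (λ k → a (step k ⟨$⟩ˡ v)) ≤ 120) →
                 sum (λ k → a (step k ⟨$⟩ˡ 5F)) ≤ 118 → 117 ≤ sum a →
                 5 * a 5F + 3 * a 4F + a 3F ≤ 175
weighted-count a rows top total = weighted-bound (a 0F) (a 1F) (a 2F) (a 3F) (a 4F) (a 5F)
  (subst (_≤ 120) (first (a 0F) (a 1F)) (rows 0F))
  (subst (_≤ 120) (second (a 0F) (a 1F) (a 2F)) (rows 1F))
  (subst (_≤ 120) (fourth (a 2F) (a 3F) (a 4F)) (rows 3F))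
  (subst (_≤ 120) (fifth (a 3F) (a 4F) (a 5F)) (rows 4F))
  (subst (_≤ 118) (sixth (a 4F) (a 5F)) top)
  (subst (117 ≤_) (all-six (a 0F) (a 1F) (a 2F) (a 3F) (a 4F) (a 5F)) total)
  where
  -- The left sides are the row sums as they evaluate, one summand per step with the identity first.
  first : ∀ x y → x + (y + (x + (x + (x + (x + 0))))) ≡ 5 * x + y
  first = solve-∀
  second : ∀ x y z → y + (x + (z + (y + (y + (y + 0))))) ≡ x + 4 * y + z
  second = solve-∀
  fourth : ∀ x y z → y + (y + (y + (x + (z + (y + 0))))) ≡ x + 4 * y + z
  fourth = solve-∀
  fifth : ∀ x y z → y + (y + (y + (y + (x + (z + 0))))) ≡ x + 4 * y + z
  fifth = solve-∀
  sixth : ∀ x y → y + (y + (y + (y + (y + (x + 0))))) ≡ x + 5 * y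
  sixth = solve-∀
  all-six : ∀ u v w x y z → u + (v + (w + (x + (y + (z + 0))))) ≡ u + v + w + x + y + z
  all-six = solve-∀

module Six (C : List (Permutation′ 6)) (code : IsCode 3 C) where
  open Code C code

  occupancy : Fin 6 → Fin 6 → ℕ
  occupancy p v = count (λ c → c ⟨$⟩ʳ p Finₚ.≟ v) C

  row-count : ∀ p v → sum (λ k → count (λ c → (c ∘ₚ step k) ⟨$⟩ʳ p Finₚ.≟ v) C) ≡
                      sum (λ k → occupancy p (step k ⟨$⟩ˡ v))
  row-count p v = sum-cong-≗ λ k → count-≐ (λ c → (c ∘ₚ step k) ⟨$⟩ʳ p Finₚ.≟ v) (λ c → c ⟨$⟩ʳ p Finₚ.≟ step k ⟨$⟩ˡ v)
    (step-⟨$⟩ k) (step-⟨$⟩′ k) C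

  row : ∀ p v → sum (λ k → occupancy p (step k ⟨$⟩ˡ v)) ≤ 120
  row p v = subst (_≤ 120) (row-count p v)
    (packing-bound (λ σ → σ ⟨$⟩ʳ p Finₚ.≟ v) (atMost-one p v) [] [] [] [])

  -- A coset of `S₅`, which permutes the values below the top one; only the step exchanging 4 and 5
  -- leaves it.
  AtTop : Fin 6 → Pred (Permutation′ 6) 0ℓ
  AtTop p σ = σ ⟨$⟩ʳ p ≡ 5F

  act-atTop : ∀ p b → AtTop p b → All (λ h → AtTop p (b ∘ₚ act h)) S₅
  act-atTop p b top = All.map (λ {h} fix → trans (cong (act h ⟨$⟩ʳ_) top) fix) act-fixes-top

  step-atTop : ∀ p b c k → k ≢ 5F → (c ∘ₚ step k) ≈ₚ b → AtTop p b → AtTop p c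
  step-atTop p b c k k≢5 eq top = trans (sym (step-involutive k _))
    (trans (cong (step k ⟨$⟩ʳ_) (trans (eq p) top)) (step-fixes-top k k≢5))

  top-row : ∀ p → 2 + sum (λ k → occupancy p (step k ⟨$⟩ˡ 5F)) ≤ 120
  top-row p =
    let open Cosets C code (AtTop p)
        u , u-top , ¬cov = uncovered-exists S₅ 4F codeword-cert₆ external-cert₆ (here refl)
          codeword-refuted₆ external-refuted₆ (act-atTop p) (step-atTop p) (transpose p 5F) (transpose-top p)
        w , w-top , ¬cov′ , u≉w = another-uncovered S₅∖e uncovered-cert₆ uncovered-refuted₆ act-moves
          u (Allₚ.drop⁺ 1 (act-atTop p u u-top)) ¬cov
    in subst (λ s → 2 + s ≤ 120) (row-count p 5F)
         (packing-bound (λ σ → σ ⟨$⟩ʳ p Finₚ.≟ 5F) (atMost-one p 5F) (u ∷ w ∷ [])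
           ((u≉w ∷ []) ∷ [] ∷ []) (u-top ∷ w-top ∷ []) (¬cov ∷ ¬cov′ ∷ []))
    where
    transpose-top : ∀ p → transpose p 5F ⟨$⟩ʳ p ≡ 5F
    transpose-top p rewrite dec-true (p Finₚ.≟ p) refl = refl

  total : ∀ p → sum (occupancy p) ≡ length C
  total p = sym (length≡sum-count (_⟨$⟩ʳ p) C)

  column : ∀ v → sum (λ p → occupancy p v) ≡ length C
  column v = sym (trans (length≡sum-count (_⟨$⟩ˡ v) C) (sum-cong-≗ λ p →
    count-≐ (λ c → c ⟨$⟩ˡ v Finₚ.≟ p) (λ c → c ⟨$⟩ʳ p Finₚ.≟ v)
      (λ {c} eq → trans (cong (c ⟨$⟩ʳ_) (sym eq)) (inverseʳ c))
      (λ {c} eq → trans (cong (c ⟨$⟩ˡ_) (sym eq)) (inverseˡ c)) C))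

  -- Every codeword takes each value at exactly one position, so each column sums to the size of the
  -- code; the weights add up to 5 + 3 + 1.
  nine : 9 * length C ≡ sum (λ p → 5 * occupancy p 5F + 3 * occupancy p 4F + occupancy p 3F)
  nine = sym (begin
    sum (λ p → 5 * a 5F p + 3 * a 4F p + a 3F p)
      ≡⟨ ∑-distrib-+ (λ p → 5 * a 5F p + 3 * a 4F p) (a 3F) ⟩
    sum (λ p → 5 * a 5F p + 3 * a 4F p) + sum (a 3F)
      ≡⟨ cong (_+ sum (a 3F)) (∑-distrib-+ (λ p → 5 * a 5F p) (λ p → 3 * a 4F p)) ⟩
    sum (λ p → 5 * a 5F p) + sum (λ p → 3 * a 4F p) + sum (a 3F)
      ≡⟨ cong₂ (λ x y → x + y + sum (a 3F)) (*-distribˡ-sum 5 (a 5F)) (*-distribˡ-sum 3 (a 4F)) ⟨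
    5 * sum (a 5F) + 3 * sum (a 4F) + sum (a 3F)
      ≡⟨ cong₂ _+_ (cong₂ _+_ (cong (5 *_) (column 5F)) (cong (3 *_) (column 4F))) (column 3F) ⟩
    5 * length C + 3 * length C + length C
      ≡⟨ collect (length C) ⟩
    9 * length C ∎)
    where
    open ≡-Reasoning
    a : Fin 6 → Fin 6 → ℕ
    a v p = occupancy p v
    collect : ∀ x → 5 * x + 3 * x + x ≡ 9 * x
    collect = solve-∀

  length-bound : length C ≤ 116
  length-bound = ≮⇒≥ λ 116<C → <⇒≱ (from-yes (6 * 175 <? 9 * 117)) (begin
    9 * 117         ≤⟨ *-monoʳ-≤ 9 116<C ⟩
    9 * length C    ≡⟨ nine ⟩
    sum (λ p → 5 * occupancy p 5F + 3 * occupancy p 4F + occupancy p 3F)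
      ≤⟨ sum-mono-≤ (λ p → weighted-count (occupancy p) (row p) (s≤s⁻¹ (s≤s⁻¹ (top-row p))) (subst (117 ≤_) (sym (total p)) 116<C)) ⟩
    sum {6} (λ _ → 175) ≡⟨⟩
    6 * 175         ∎)
    where open ≤-Reasoning

-- Seven points

codeword-refuted₇ : Refutes S₄×S₃ [] ([] ∷ []) codeword-cert₇
codeword-refuted₇ = refl

external-refuted₇ : Refutes S₄×S₃ [] ((3F ∷ []) ∷ []) external-cert₇
external-refuted₇ = refl

-- `S₄×S₃` permutes the values 0 to 3 and the values 4 to 6 separately, so a coset is given by the
-- four positions of its low values; there are 35 of them.
isLow : Fin 7 → Bool
isLow x = toℕ x <ᵇ 4

act-preserves-isLow : All (λ h → ∀ x → isLow (act h ⟨$⟩ʳ x) ≡ isLow x) S₄×S₃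
act-preserves-isLow = from-yes (All.all? (λ h → all? λ x → isLow (act h ⟨$⟩ʳ x) Boolₚ.≟ isLow x) S₄×S₃)

step-preserves-isLow : ∀ (k : Fin 7) → k ≢ 4F → ∀ x → isLow (step k ⟨$⟩ʳ x) ≡ isLow x
step-preserves-isLow = from-yes (all? λ k → ¬? (k Finₚ.≟ 4F) →-dec all? λ x → isLow (step k ⟨$⟩ʳ x) Boolₚ.≟ isLow x)

-- The generators `g`, `g - 1`, and so on, `l` in number; `l` never exceeds `g + 1` below, so the
-- subtraction does not truncate.
descending : Fin 6 → ℕ → List (Fin 6)
descending g l = applyUpTo (λ i → fromℕ< (<-≤-trans (s≤s (m∸n≤m (toℕ g) i)) (toℕ<n g))) l

-- Minimal representatives of the right cosets of S₄ × S₃: the values 0, …, 3 are brought to any four positions.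
representatives : List (List (Fin 6))
representatives = concatMap (λ i → concatMap (λ j → map (λ k → descending 3F i ++ descending 4F j ++ descending 5F k)
  (upTo (suc j))) (upTo (suc i))) (upTo 5)

Apart : List (Fin 6) → List (Fin 6) → Set
Apart r s = ¬ (∀ x → isLow (act r ⟨$⟩ʳ x) ≡ isLow (act s ⟨$⟩ʳ x))

representatives-apart : AllPairs Apart representatives
representatives-apart = from-yes (allPairs?
  (λ r s → ¬? (all? λ x → isLow (act r ⟨$⟩ʳ x) Boolₚ.≟ isLow (act s ⟨$⟩ʳ x))) representatives)

module Seven (C : List (Permutation′ 7)) (code : IsCode 3 C) where
  open Code C code

  SameCoset : Permutation′ 7 → Pred (Permutation′ 7) 0ℓ
  SameCoset ρ σ = ∀ x → isLow (σ ⟨$⟩ʳ x) ≡ isLow (ρ ⟨$⟩ʳ x)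

  act-coset : ∀ ρ b → SameCoset ρ b → All (λ h → SameCoset ρ (b ∘ₚ act h)) S₄×S₃
  act-coset ρ b same = All.map (λ preserves x → trans (preserves (b ⟨$⟩ʳ x)) (same x)) act-preserves-isLow

  step-coset : ∀ ρ b c k → k ≢ 4F → (c ∘ₚ step k) ≈ₚ b → SameCoset ρ b → SameCoset ρ c
  step-coset ρ b c k k≢4 eq same x = trans (sym (step-preserves-isLow k k≢4 (c ⟨$⟩ʳ x)))
    (trans (cong isLow (eq x)) (same x))

  -- Only the stated properties of the witnesses matter later; the search behind them stays folded.
  abstract
    uncovered-in : ∀ r → ∃ λ u → SameCoset (act r) u × ¬ Covered u
    uncovered-in r = Cosets.uncovered-exists C code (SameCoset (act r)) S₄×S₃ 3F codeword-cert₇ external-cert₇ (here refl)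
      codeword-refuted₇ external-refuted₇ (act-coset (act r)) (step-coset (act r)) (act r) (λ _ → refl)

  uncovered-distinct : ∀ {rs} → AllPairs Apart rs → Distinct (map (proj₁ ∘ uncovered-in) rs)
  uncovered-distinct apart = AllPairsₚ.map⁺ (AllPairs.map
    (λ {r} {s} r#s eq → r#s λ x → trans (sym (proj₁ (proj₂ (uncovered-in r)) x))
      (trans (cong isLow (eq x)) (proj₁ (proj₂ (uncovered-in s)) x))) apart)

  uncovered-bound : ∀ rs → AllPairs Apart rs → length rs + 7 * length C ≤ 5040
  uncovered-bound rs apart = subst (λ l → l + 7 * length C ≤ 5040) (length-map (proj₁ ∘ uncovered-in) rs)
    (total-bound (map (proj₁ ∘ uncovered-in) rs) (uncovered-distinct apart)
      (Allₚ.map⁺ (All.universal (proj₂ ∘ proj₂ ∘ uncovered-in) rs)))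

  length-bound : length C ≤ 716
  -- With 35 uncovered, at most 5005 permutations are covered, whereas 717 codewords would cover
  -- 5019.
  length-bound = ≮⇒≥ λ 716<C → <⇒≱ (from-yes (5040 <? 35 + 7 * 717))
    (≤-trans (+-monoʳ-≤ 35 (*-monoʳ-≤ 7 716<C)) (uncovered-bound representatives representatives-apart))

theorem3p5 : P≤ 6 3 116 × P≤ 7 3 716 × P≤ 11 3 ((10 !) ∸ 10)
    × P≤ 13 3 ((12 !) ∸ 12) × P≤ 17 3 ((16 !) ∸ 5)
theorem3p5 = Six.length-bound , Seven.length-bound , P≤-11 , P≤-13 , P≤-17
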